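{- For any choice of $\boldsymbol{w}$, the complement of the graph $G^{\boldsymbol{w}}$ is isomorphic to the graph $\Gamma_1$.
   Context: The $E_8$ root system $\Psi_{E_8}\subset\mathbb{R}^8$ consists of the 240 vectors $\pm e_i\pm e_j$ ($1\le i<j\le 8$) and all $x\in\{\pm1\}^8$ with $\prod_i x_i=1$. $G_{E_8}$ is the graph with vertices $v_x$, $x\in\Psi_{E_8}$, where $v_x=v_{ -x}$, and $v_x\sim v_y$ iff $\langle x,y\rangle=0$. Let $I=\mathrm{diag}(1,1)$, $X=\begin{pmatrix}0&1\\1&0\end{pmatrix}$, $Z=\mathrm{diag}(1,-1)$, $Y=XZ$. For $M=M_1\otimes M_2\otimes M_3$ with $M_i\in\{I,X,Y,Z\}$, $\sigma_M:v_x\mapsto v_{Mx}$ is an automorphism of $G_{E_8}$ and $L=\{\sigma_M\}\cong\mathbb{Z}_2^6$. Let $V_1,\dots,V_{15}$ be the 15 orbits of $L$ on $V(G_{E_8})$. Given vectors $\boldsymbol{w}=\{w_1,\dots,w_{15}\}\subset\Psi_{E_8}$ with $v_{w_i}\in V_i$, the graph $G^{\boldsymbol{w}}$ has vertex set $V(G_{E_8})$; for $s\in V_i$, $t\in V_j$: if $\langle w_i,w_j\rangle\neq0$ then $s\sim t$ in $G^{\boldsymbol{w}}$ iff $s\sim t$ in $G_{E_8}$; if $\langle w_i,w_j\rangle=0$ then $s\sim t$ in $G^{\boldsymbol{w}}$ iff $s\not\sim t$ in $G_{E_8}$. The folded halved 8-cube graph has as vertices the pairs $\{x,\mathbf{1}+x\}$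 for $x\in\mathbb{F}_2^8$ with $\sum_ix_i=0$ ($\mathbf{1}$ the all-ones vector), two vertices $\{x,\mathbf{1}+x\},\{y,\mathbf{1}+y\}$ being adjacent iff $x+y$ or $x+y+\mathbf{1}$ has exactly two nonzero coordinates. The graph $\Gamma_1$ (Brouwer–Ivanov–Klin) has as vertices one orbit of the independent sets of size 8 of the folded halved 8-cube graph under the group $\mathbb{Z}_2^6\times A_8$ (generated by translations by even-weight vectors and even permutations of the 8 coordinates), namely the orbit of size 120 considered by Brouwer, Ivanov and Klin, giving a strongly regular graph with parameters $(120,56,28,24)$; two vertices are adjacent iff the corresponding independent sets have exactly two points in common. -}

module Defs where

open import Data.Bool.Base using (Bool; T)
open import Data.Fin.Base using (Fin; zero; quotient; remainder) renaming (_<_ to _<ᶠ_)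
open import Data.Fin.Permutation as Perm using (Permutation′; _⟨$⟩ˡ_)
open import Data.Fin.Permutation.Transposition.List using (TranspositionList; eval)
open import Data.Fin.Properties using (injective⇒≤; <⇒≢) renaming (_≟_ to _≟ᶠ_)
open import Data.Integer.Base using (ℤ; 0ℤ; 1ℤ; -1ℤ; _+_; _*_; -_; _◃_; _≤_; +≤+; -[1+_]) renaming (+_ to pos)
open import Data.List.Base using (List; foldr; length)
open import Data.List.Relation.Unary.All using (All)
open import Data.Nat.Base using (ℕ; z≤n; s≤s) renaming (_*_ to _*ᴺ_)
open import Data.Nat.Divisibility using (_∣_)
open import Data.Parity.Base using (Parity; 0ℙ; 1ℙ) renaming (_+_ to _⊞_)
open import Data.Product.Base using (Σ-syntax; ∃-syntax; _×_; _,_; proj₁; proj₂; swap)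
open import Data.Sign.Base using (Sign) renaming (+ to ⊕; - to ⊖)
open import Data.Sum.Base using (_⊎_; inj₁; inj₂) renaming (map to map⊎; swap to swap⊎)
open import Data.Vec.Base using (count; tabulate)
open import Data.Vec.Functional using (Vector; []; _∷_) renaming (foldr to foldrᵛ)
open import Data.Vec.Properties using (tabulate-cong)
open import Function.Base using (_∘_)
open import Function.Bundles using (Inverse; _⇔_; mk⇔; module Equivalence)
open import Level using (0ℓ)
open import Relation.Binary.Bundles using (Setoid)
open import Relation.Binary.Core using (Rel)
open import Relation.Binary.Definitions using (Symmetric; Irreflexive; _Respects₂_)
open import Relation.Binary.PropositionalEquality using (_≡_; _≢_; refl; sym; trans; cong; cong₂; subst; module ≡-Reasoning)
open import Relation.Nullary.Decidable.Core using (yes; no; ¬?)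
open import Relation.Nullary.Negation.Core using (¬_; contradiction)
open import Relation.Unary using (Pred; _∈_; _∩_)
import Algebra.Properties.CommutativeMonoid.Sum as Sum
import Data.Integer.Properties as ℤ
import Data.Parity.Properties as ℙ

open Sum ℤ.+-0-commutativeMonoid using (sum; sum-cong-≗)
open Sum ℙ.+-0-commutativeMonoid using () renaming (sum to sumℙ; sum-permute to sumℙ-permute; ∑-distrib-+ to sumℙ-distrib)

-- Vertex sets are setoids, because the vertices below are
-- classes {x , -x} and {x , 𝟏 + x}.

record Graph : Set₁ where
  field
    vertices : Setoid 0ℓ 0ℓ
  open Setoid vertices public using (Carrier; _≈_)
  infix 4 _∼_
  field
    _∼_    : Rel Carrier 0ℓ
    ∼-sym  : Symmetric _∼_
    irrefl : Irreflexive _≈_ _∼_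
    resp   : _∼_ Respects₂ _≈_

complement : Graph → Graph
complement G = record
  { vertices = vertices
  ; _∼_      = λ x y → ¬ (x ≈ y) × ¬ (x ∼ y)
  ; ∼-sym    = λ (x≉y , x≁y) → x≉y ∘ V.sym , x≁y ∘ ∼-sym
  ; irrefl   = λ x≈y (x≉y , _) → x≉y x≈y
  ; resp     =
      (λ y≈z (x≉y , x≁y) → (λ x≈z → x≉y (V.trans x≈z (V.sym y≈z))) , x≁y ∘ proj₁ resp (V.sym y≈z))
    , (λ y≈z (y≉x , y≁x) → (λ z≈x → y≉x (V.trans y≈z z≈x)) , y≁x ∘ proj₂ resp (V.sym y≈z))
  }
  where
  open Graph G
  module V = Setoid vertices

infix 4 _≅_

record _≅_ (G H : Graph) : Set where
  private
    module G = Graph G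
    module H = Graph H
  field
    bijection : Inverse G.vertices H.vertices
  open Inverse bijection public using (to; from)
  field
    adjacency : ∀ x y → x G.∼ y ⇔ to x H.∼ to y

Matrix : ℕ → ℕ → Set
Matrix m n = Fin m → Fin n → ℤ

⟨_,_⟩ : ∀ {n} → Vector ℤ n → Vector ℤ n → ℤ
⟨ x , y ⟩ = sum (λ k → x k * y k)

product : ∀ {n} → Vector ℤ n → ℤ
product = foldrᵛ _*_ 1ℤ

infixr 7 _·ᵥ_ _·ₘ_ _⊗_

_·ᵥ_ : ∀ {m n} → Matrix m n → Vector ℤ n → Vector ℤ m
(A ·ᵥ x) i = ⟨ A i , x ⟩

_·ₘ_ : ∀ {m n p} → Matrix m n → Matrix n p → Matrix m p
(A ·ₘ B) i k = sum (λ j → A i j * B j k)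

-- Kronecker product, with the lexicographic identification of
-- Fin m × Fin p with Fin (m * p).
_⊗_ : ∀ {m n p q} → Matrix m n → Matrix p q → Matrix (m *ᴺ p) (n *ᴺ q)
_⊗_ {m} {n} {p} {q} A B i j =
  A (quotient p i) (quotient q j) * B (remainder {m} p i) (remainder {n} q j)

basis : ∀ {n} → Fin n → Vector ℤ n
basis i k with i ≟ᶠ k
... | yes _ = 1ℤ
... | no  _ = 0ℤ

infix 4 _≈±_

_≈±_ : ∀ {n} → Rel (Vector ℤ n) 0ℓ
x ≈± y = (∀ k → x k ≡ y k) ⊎ (∀ k → x k ≡ - y k)

≈±-refl : ∀ {n} {x : Vector ℤ n} → x ≈± x
≈±-refl = inj₁ λ _ → refl

≈±-sym : ∀ {n} {x y : Vector ℤ n} → x ≈± y → y ≈± x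
≈±-sym         (inj₁ p) = inj₁ λ k → sym (p k)
≈±-sym {y = y} (inj₂ p) = inj₂ λ k → sym (trans (cong -_ (p k)) (ℤ.neg-involutive (y k)))

≈±-trans : ∀ {n} {x y z : Vector ℤ n} → x ≈± y → y ≈± z → x ≈± z
≈±-trans         (inj₁ p) (inj₁ q) = inj₁ λ k → trans (p k) (q k)
≈±-trans         (inj₁ p) (inj₂ q) = inj₂ λ k → trans (p k) (q k)
≈±-trans         (inj₂ p) (inj₁ q) = inj₂ λ k → trans (p k) (cong -_ (q k))
≈±-trans {z = z} (inj₂ p) (inj₂ q) = inj₁ λ k → trans (p k) (trans (cong -_ (q k)) (ℤ.neg-involutive (z k)))

⟨⟩-comm : ∀ {n} (x y : Vector ℤ n) → ⟨ x , y ⟩ ≡ ⟨ y , x ⟩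
⟨⟩-comm x y = sum-cong-≗ (λ k → ℤ.*-comm (x k) (y k))

sum-neg : ∀ {n} (f : Vector ℤ n) → sum (λ k → - f k) ≡ - sum f
sum-neg {ℕ.zero}  f = refl
sum-neg {ℕ.suc n} f = begin
  - f zero + sum (λ k → - f (Fin.suc k)) ≡⟨ cong (- f zero +_) (sum-neg (f ∘ Fin.suc)) ⟩
  - f zero + - sum (f ∘ Fin.suc)         ≡⟨ ℤ.neg-distrib-+ (f zero) _ ⟨
  - (f zero + sum (f ∘ Fin.suc))         ∎
  where open ≡-Reasoning

⊥-respʳ : ∀ {n} (x : Vector ℤ n) {y z} → y ≈± z → ⟨ x , y ⟩ ≡ 0ℤ → ⟨ x , z ⟩ ≡ 0ℤ
⊥-respʳ x         (inj₁ p) x⊥y = trans (sum-cong-≗ (λ k → cong (x k *_) (sym (p k)))) x⊥y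
⊥-respʳ x {y} {z} (inj₂ p) x⊥y = begin
  ⟨ x , z ⟩                   ≡⟨ ℤ.neg-involutive _ ⟨
  - (- ⟨ x , z ⟩)             ≡⟨ cong -_ (sum-neg (λ k → x k * z k)) ⟨
  - sum (λ k → - (x k * z k)) ≡⟨ cong -_ (sum-cong-≗ (λ k → trans (ℤ.neg-distribʳ-* (x k) (z k)) (cong (x k *_) (sym (p k))))) ⟩
  - ⟨ x , y ⟩                 ≡⟨ cong -_ x⊥y ⟩
  0ℤ                          ∎
  where open ≡-Reasoning

⊥-respˡ : ∀ {n} (x : Vector ℤ n) {y z} → y ≈± z → ⟨ y , x ⟩ ≡ 0ℤ → ⟨ z , x ⟩ ≡ 0ℤ
⊥-respˡ x {y} {z} y≈z y⊥x = trans (⟨⟩-comm z x) (⊥-respʳ x y≈z (trans (⟨⟩-comm x y) y⊥x))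

-- The two kinds of roots are deliberately not scaled to a common length:
-- only orthogonality is used, and so ℤ⁸ can replace ℝ⁸.

±1 : Sign → ℤ
±1 s = s ◃ 1

data IsRoot (x : Vector ℤ 8) : Set where
  ±eᵢ±eⱼ : ∀ i j → i <ᶠ j → (s t : Sign) →
           (∀ k → x k ≡ ±1 s * basis i k + ±1 t * basis j k) → IsRoot x
  signs  : (∀ k → x k ≡ 1ℤ ⊎ x k ≡ -1ℤ) → product x ≡ 1ℤ → IsRoot x

record Root : Set where
  field
    vec    : Vector ℤ 8
    isRoot : IsRoot vec

open Root public

sq-nonneg : ∀ a → 0ℤ ≤ a * a
sq-nonneg (pos ℕ.zero)   = +≤+ z≤n
sq-nonneg (pos (ℕ.suc _))= +≤+ z≤n
sq-nonneg -[1+ _ ]        = +≤+ z≤n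

sum-nonneg : ∀ {n} (f : Vector ℤ n) → (∀ k → 0ℤ ≤ f k) → 0ℤ ≤ sum f
sum-nonneg {ℕ.zero}  f 0≤f = ℤ.≤-refl
sum-nonneg {ℕ.suc n} f 0≤f = ℤ.+-mono-≤ (0≤f zero) (sum-nonneg (f ∘ Fin.suc) (0≤f ∘ Fin.suc))

term≤sum : ∀ {n} (f : Vector ℤ n) → (∀ k → 0ℤ ≤ f k) → ∀ k → f k ≤ sum f
term≤sum f 0≤f zero        =
  subst (_≤ sum f) (ℤ.+-identityʳ (f zero)) (ℤ.+-monoʳ-≤ (f zero) (sum-nonneg _ (0≤f ∘ Fin.suc)))
term≤sum f 0≤f (Fin.suc k) =
  subst (_≤ sum f) (ℤ.+-identityˡ (f (Fin.suc k))) (ℤ.+-mono-≤ (0≤f zero) (term≤sum _ (0≤f ∘ Fin.suc) k))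

unit-coordinate : ∀ x → IsRoot x → ∃[ k ] x k * x k ≡ 1ℤ
unit-coordinate x (signs p _) with p zero
... | inj₁ eq = zero , cong₂ _*_ eq eq
... | inj₂ eq = zero , cong₂ _*_ eq eq
unit-coordinate x (±eᵢ±eⱼ i j i<j s t p) = i , trans (cong₂ _*_ xᵢ xᵢ) (square s)
  where
  square : ∀ s → ±1 s * ±1 s ≡ 1ℤ
  square ⊕ = refl
  square ⊖ = refl

  basis-diag : basis i i ≡ 1ℤ
  basis-diag with i ≟ᶠ i
  ... | yes _  = refl
  ... | no i≢i = contradiction refl i≢i

  basis-off : basis j i ≡ 0ℤ
  basis-off with j ≟ᶠ i
  ... | yes j≡i = contradiction (sym j≡i) (<⇒≢ i<j)
  ... | no _    = refl

  xᵢ : x i ≡ ±1 s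
  xᵢ = begin
    x i                                 ≡⟨ p i ⟩
    ±1 s * basis i i + ±1 t * basis j i ≡⟨ cong₂ (λ a b → ±1 s * a + ±1 t * b) basis-diag basis-off ⟩
    ±1 s * 1ℤ + ±1 t * 0ℤ               ≡⟨ cong₂ _+_ (ℤ.*-identityʳ (±1 s)) (ℤ.*-zeroʳ (±1 t)) ⟩
    ±1 s + 0ℤ                           ≡⟨ ℤ.+-identityʳ (±1 s) ⟩
    ±1 s                                ∎
    where open ≡-Reasoning

root-anisotropic : ∀ x → IsRoot x → ⟨ x , x ⟩ ≢ 0ℤ
root-anisotropic x r x⊥x with k , eq ← unit-coordinate x r
  with subst (_≤ 0ℤ) eq (subst (x k * x k ≤_) x⊥x (term≤sum _ (λ k → sq-nonneg (x k)) k))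
... | +≤+ ()

-- The root x stands for the vertex v_x = v_{-x}.
lines : Setoid 0ℓ 0ℓ
lines = record
  { Carrier       = Root
  ; _≈_           = λ x y → vec x ≈± vec y
  ; isEquivalence = record { refl = ≈±-refl ; sym = ≈±-sym ; trans = ≈±-trans }
  }

G-E₈ : Graph
G-E₈ = record
  { vertices = lines
  ; _∼_      = λ x y → ⟨ vec x , vec y ⟩ ≡ 0ℤ
  ; ∼-sym    = λ {x} {y} x⊥y → trans (⟨⟩-comm (vec y) (vec x)) x⊥y
  ; irrefl   = λ {x} x≈y x⊥y → root-anisotropic (vec x) (isRoot x) (⊥-respʳ (vec x) (≈±-sym x≈y) x⊥y)
  ; resp     = (λ {x} → ⊥-respʳ (vec x)) , (λ {x} → ⊥-respˡ (vec x))
  }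

data Pauli : Set where
  I X Y Z : Pauli

⟦_⟧ : Pauli → Matrix 2 2
⟦ I ⟧ = (1ℤ ∷ 0ℤ ∷ []) ∷ (0ℤ ∷ 1ℤ ∷ []) ∷ []
⟦ X ⟧ = (0ℤ ∷ 1ℤ ∷ []) ∷ (1ℤ ∷ 0ℤ ∷ []) ∷ []
⟦ Z ⟧ = (1ℤ ∷ 0ℤ ∷ []) ∷ (0ℤ ∷ -1ℤ ∷ []) ∷ []
⟦ Y ⟧ = ⟦ X ⟧ ·ₘ ⟦ Z ⟧

tensor : Pauli → Pauli → Pauli → Matrix 8 8
tensor M₁ M₂ M₃ = ⟦ M₁ ⟧ ⊗ ⟦ M₂ ⟧ ⊗ ⟦ M₃ ⟧

-- v_y = σ_M(v_x) for some M
SameOrbit : Rel Root 0ℓ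
SameOrbit x y = ∃[ M₁ ] ∃[ M₂ ] ∃[ M₃ ] vec y ≈± tensor M₁ M₂ M₃ ·ᵥ vec x

-- An enumeration V₁ , … , V₁₅ of the orbits of L, given by the map sending
-- each vertex to the index of its orbit.
record OrbitEnumeration : Set where
  field
    index      : Root → Fin 15
    cong-index : ∀ {x y} → vec x ≈± vec y → index x ≡ index y
    orbits     : ∀ x y → index x ≡ index y ⇔ SameOrbit x y
    onto       : ∀ i → ∃[ x ] index x ≡ i

  V : Fin 15 → Pred Root 0ℓ
  V i x = index x ≡ i

module _ (𝓥 : OrbitEnumeration) (w : Fin 15 → Root) where
  open OrbitEnumeration 𝓥
  open Graph G-E₈ using (_∼_; ∼-sym; irrefl; resp)

  private
    W : Root → Root → ℤ
    W s t = ⟨ vec (w (index s)) , vec (w (index t)) ⟩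

    W-sym : ∀ s t → W s t ≡ W t s
    W-sym s t = ⟨⟩-comm (vec (w (index s))) (vec (w (index t)))

    W-congʳ : ∀ s {t u} → vec t ≈± vec u → W s t ≡ W s u
    W-congʳ s t≈u = cong (λ i → ⟨ vec (w (index s)) , vec (w i) ⟩) (cong-index t≈u)

    W-diag : ∀ s → W s s ≢ 0ℤ
    W-diag s = root-anisotropic _ (isRoot (w (index s)))

  Switched : Rel Root 0ℓ
  Switched s t =
      (⟨ vec (w (index s)) , vec (w (index t)) ⟩ ≢ 0ℤ × s ∼ t)
    ⊎ (⟨ vec (w (index s)) , vec (w (index t)) ⟩ ≡ 0ℤ × ¬ (s ∼ t))

  private
    Switched-sym : Symmetric Switched
    Switched-sym {s} {t} (inj₁ (W≢0 , s∼t)) =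
      inj₁ ((λ eq → W≢0 (trans (W-sym s t) eq)) , ∼-sym {s} {t} s∼t)
    Switched-sym {s} {t} (inj₂ (W≡0 , s≁t)) =
      inj₂ (trans (W-sym t s) W≡0 , λ t∼s → s≁t (∼-sym {t} {s} t∼s))

    Switched-respʳ : ∀ {s t u} → vec t ≈± vec u → Switched s t → Switched s u
    Switched-respʳ {s} {t} {u} t≈u (inj₁ (W≢0 , s∼t)) =
      inj₁ ((λ eq → W≢0 (trans (W-congʳ s {t} {u} t≈u) eq)) , proj₁ resp {s} {t} {u} t≈u s∼t)
    Switched-respʳ {s} {t} {u} t≈u (inj₂ (W≡0 , s≁t)) =
      inj₂ (trans (sym (W-congʳ s {t} {u} t≈u)) W≡0 , λ s∼u → s≁t (proj₁ resp {s} {u} {t} (≈±-sym t≈u) s∼u))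

    Switched-irrefl : ∀ {s t} → vec s ≈± vec t → ¬ Switched s t
    Switched-irrefl {s} {t} s≈t (inj₁ (_ , s∼t)) = irrefl {s} {t} s≈t s∼t
    Switched-irrefl {s} {t} s≈t (inj₂ (W≡0 , _)) = W-diag s (trans (W-congʳ s {s} {t} s≈t) W≡0)

  G^ : Graph
  G^ = record
    { vertices = lines
    ; _∼_      = Switched
    ; ∼-sym    = Switched-sym
    ; irrefl   = Switched-irrefl
    ; resp     = Switched-respʳ
               , (λ {s} {t} {u} t≈u t∼s → Switched-sym {s} {u} (Switched-respʳ {s} {t} {u} t≈u (Switched-sym {t} {s} t∼s)))
    }

-- Parity plays the role of 𝔽₂.

infixl 6 _⊞ᵥ_

_⊞ᵥ_ : ∀ {n} → Vector Parity n → Vector Parity n → Vector Parity n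
(x ⊞ᵥ y) k = x k ⊞ y k

𝟏 : ∀ {n} → Vector Parity n
𝟏 _ = 1ℙ

weight : ∀ {n} → Vector Parity n → ℕ
weight x = count (λ a → ¬? (a ℙ.≟ 0ℙ)) (tabulate x)

weight-cong : ∀ {n} {x y : Vector Parity n} → (∀ k → x k ≡ y k) → weight x ≡ weight y
weight-cong p = cong (count (λ a → ¬? (a ℙ.≟ 0ℙ))) (tabulate-cong p)

-- A point p stands for the pair {coords p , 𝟏 + coords p}.
record Point : Set where
  field
    coords : Vector Parity 8
    even   : sumℙ coords ≡ 0ℙ

open Point public

infix 4 _≈₁_

_≈₁_ : Rel Point 0ℓ
p ≈₁ q = (∀ k → coords p k ≡ coords q k) ⊎ (∀ k → coords p k ≡ 1ℙ ⊞ coords q k)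

private
  1+1+ : ∀ a → 1ℙ ⊞ (1ℙ ⊞ a) ≡ a
  1+1+ 0ℙ = refl
  1+1+ 1ℙ = refl

≈₁-sym : Symmetric _≈₁_
≈₁-sym         (inj₁ e) = inj₁ λ k → sym (e k)
≈₁-sym {y = q} (inj₂ e) = inj₂ λ k → sym (trans (cong (1ℙ ⊞_) (e k)) (1+1+ (coords q k)))

≈₁-trans : ∀ {p q r} → p ≈₁ q → q ≈₁ r → p ≈₁ r
≈₁-trans         (inj₁ e) (inj₁ f) = inj₁ λ k → trans (e k) (f k)
≈₁-trans         (inj₁ e) (inj₂ f) = inj₂ λ k → trans (e k) (f k)
≈₁-trans         (inj₂ e) (inj₁ f) = inj₂ λ k → trans (e k) (cong (1ℙ ⊞_) (f k))
≈₁-trans {r = r} (inj₂ e) (inj₂ f) = inj₁ λ k → trans (e k) (trans (cong (1ℙ ⊞_) (f k)) (1+1+ (coords r k)))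

points : Setoid 0ℓ 0ℓ
points = record
  { Carrier       = Point
  ; _≈_           = _≈₁_
  ; isEquivalence = record
    { refl  = inj₁ λ _ → refl
    ; sym   = λ {p} {q} → ≈₁-sym {p} {q}
    ; trans = λ {p} {q} {r} → ≈₁-trans {p} {q} {r}
    }
  }

Adjacent : Rel Point 0ℓ
Adjacent p q = weight (coords p ⊞ᵥ coords q) ≡ 2 ⊎ weight (coords p ⊞ᵥ coords q ⊞ᵥ 𝟏) ≡ 2

private
  Adjacent-sym : Symmetric Adjacent
  Adjacent-sym {p} {q} = map⊎
    (trans (weight-cong λ k → ℙ.+-comm (coords q k) (coords p k)))
    (trans (weight-cong λ k → cong (_⊞ 1ℙ) (ℙ.+-comm (coords q k) (coords p k))))

  a+[1+b] : ∀ a b → a ⊞ (1ℙ ⊞ b) ≡ a ⊞ b ⊞ 1ℙ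
  a+[1+b] 0ℙ 0ℙ = refl
  a+[1+b] 0ℙ 1ℙ = refl
  a+[1+b] 1ℙ 0ℙ = refl
  a+[1+b] 1ℙ 1ℙ = refl

  a+[1+b]+1 : ∀ a b → a ⊞ (1ℙ ⊞ b) ⊞ 1ℙ ≡ a ⊞ b
  a+[1+b]+1 0ℙ 0ℙ = refl
  a+[1+b]+1 0ℙ 1ℙ = refl
  a+[1+b]+1 1ℙ 0ℙ = refl
  a+[1+b]+1 1ℙ 1ℙ = refl

  Adjacent-respʳ : ∀ {p q r} → q ≈₁ r → Adjacent p q → Adjacent p r
  Adjacent-respʳ {p} {q} {r} (inj₁ e) = map⊎
    (trans (weight-cong λ k → cong (coords p k ⊞_) (sym (e k))))
    (trans (weight-cong λ k → cong (λ a → coords p k ⊞ a ⊞ 1ℙ) (sym (e k))))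
  Adjacent-respʳ {p} {q} {r} (inj₂ e) = swap⊎ ∘ map⊎
    (trans (weight-cong λ k → trans (sym (a+[1+b] (coords p k) (coords r k)))
                                    (cong (coords p k ⊞_) (sym (e k)))))
    (trans (weight-cong λ k → trans (sym (a+[1+b]+1 (coords p k) (coords r k)))
                                    (cong (λ a → coords p k ⊞ a ⊞ 1ℙ) (sym (e k)))))

  a+a : ∀ a → a ⊞ a ≡ 0ℙ
  a+a 0ℙ = refl
  a+a 1ℙ = refl

  ¬Adjacent-self : ∀ p → ¬ Adjacent p p
  ¬Adjacent-self p (inj₁ e) with () ← trans (sym (weight-cong {y = λ _ → 0ℙ} λ k → a+a (coords p k))) e
  ¬Adjacent-self p (inj₂ e) with () ← trans (sym (weight-cong {y = 𝟏} λ k → cong (_⊞ 1ℙ) (a+a (coords p k)))) e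

FoldedHalvedCube : Graph
FoldedHalvedCube = record
  { vertices = points
  ; _∼_      = Adjacent
  ; ∼-sym    = λ {p} {q} → Adjacent-sym {p} {q}
  ; irrefl   = λ {p} {q} p≈q p∼q →
      ¬Adjacent-self p (Adjacent-respʳ {p} {q} {p} (≈₁-sym {p} {q} p≈q) p∼q)
  ; resp     = (λ {p} {q} {r} → Adjacent-respʳ {p} {q} {r})
             , (λ {p} {q} {r} q≈r q∼p →
                  Adjacent-sym {p} {r} (Adjacent-respʳ {p} {q} {r} q≈r (Adjacent-sym {q} {p} q∼p)))
  }

HasSize : Pred Point 0ℓ → ℕ → Set
HasSize P n = Σ[ f ∈ (Fin n → Point) ]
    (∀ {i j} → f i ≈₁ f j → i ≡ j)
  × (∀ p → P p ⇔ (∃[ i ] p ≈₁ f i))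

record IndependentSet : Set where
  field
    member      : Point → Bool
    cong-member : ∀ {p q} → p ≈₁ q → member p ≡ member q

  elements : Pred Point 0ℓ
  elements p = T (member p)

  field
    size        : HasSize elements 8
    independent : ∀ {p q} → p ∈ elements → q ∈ elements → ¬ Adjacent p q

open IndependentSet public

-- A product of an even number of transpositions; TranspositionList also
-- allows the trivial pairs (i , i), which have to be excluded.
record EvenPermutation : Set where
  field
    perm           : Permutation′ 8
    transpositions : TranspositionList 8
    proper         : All (λ (i , j) → i ≢ j) transpositions
    evenLength     : 2 ∣ length transpositions
    factorisation  : eval transpositions Perm.≈ perm

open EvenPermutation public

data Generator : Set where
  translation : Point → Generator
  permutation : EvenPermutation → Generator

act : Generator → Point → Point
act (translation c) p = record
  { coords = coords c ⊞ᵥ coords p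
  ; even   = trans (sumℙ-distrib (coords c) (coords p)) (cong₂ _⊞_ (even c) (even p))
  }
act (permutation π) p = record
  { coords = λ k → coords p (perm π ⟨$⟩ˡ k)
  ; even   = trans (sym (sumℙ-permute (coords p) (Perm.flip (perm π)))) (even p)
  }

-- The generators are closed under inverses, so words in them give the
-- whole group.
actWord : List Generator → Point → Point
actWord g p = foldr act p g

-- B = g(A) for some g; as g permutes the points, this says that p ∈ A
-- exactly when g(p) ∈ B.
InOrbit : IndependentSet → IndependentSet → Set
InOrbit A B = ∃[ g ] ∀ p → member A p ≡ member B (actWord g p)

-- The 240 independent sets of size 8 form two
-- orbits of size 120, interchanged by the odd permutations; Γ₁ is the graph
-- on either of them.

record OrbitElement (A₀ : IndependentSet) : Set where
  field
    set     : IndependentSet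
    inOrbit : InOrbit A₀ set

open OrbitElement public

MeetInTwo : Rel IndependentSet 0ℓ
MeetInTwo A B = HasSize (elements A ∩ elements B) 2

private
  open Equivalence

  MeetInTwo-sym : Symmetric MeetInTwo
  MeetInTwo-sym (f , inj , enum) = f , inj , λ p → mk⇔ (to (enum p) ∘ swap) (swap ∘ from (enum p))

  MeetInTwo-respʳ : ∀ A {B C} → (∀ p → member B p ≡ member C p) → MeetInTwo A B → MeetInTwo A C
  MeetInTwo-respʳ A B≗C (f , inj , enum) = f , inj , λ p → mk⇔
    (λ (p∈A , p∈C) → to (enum p) (p∈A , subst T (sym (B≗C p)) p∈C))
    (λ p≈fi → let (p∈A , p∈B) = from (enum p) p≈fi in p∈A , subst T (B≗C p) p∈B)

  ¬MeetInTwo-self : ∀ A → ¬ MeetInTwo A A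
  ¬MeetInTwo-self A (f , _ , enum) with size A
  ... | g , g-inj , g-enum with injective⇒≤ {f = λ i → proj₁ (locate i)} locate-injective
    where
    g∈A : ∀ i → g i ∈ elements A
    g∈A i = from (g-enum (g i)) (i , inj₁ λ _ → refl)

    locate : ∀ i → ∃[ j ] g i ≈₁ f j
    locate i = to (enum (g i)) (g∈A i , g∈A i)

    locate-injective : ∀ {i j} → proj₁ (locate i) ≡ proj₁ (locate j) → i ≡ j
    locate-injective {i} {j} eq = g-inj (≈₁-trans {g i} {f _} {g j}
      (subst (λ k → g i ≈₁ f k) eq (proj₂ (locate i)))
      (≈₁-sym {g j} {f _} (proj₂ (locate j))))
  ... | s≤s (s≤s ())

Γ₁ : IndependentSet → Graph
Γ₁ A₀ = record
  { vertices = record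
    { Carrier       = OrbitElement A₀
    ; _≈_           = λ A B → ∀ p → member (set A) p ≡ member (set B) p
    ; isEquivalence = record
      { refl  = λ _ → refl
      ; sym   = λ A≗B p → sym (A≗B p)
      ; trans = λ A≗B B≗C p → trans (A≗B p) (B≗C p)
      }
    }
  ; _∼_      = λ A B → MeetInTwo (set A) (set B)
  ; ∼-sym    = λ {A} {B} → MeetInTwo-sym {set A} {set B}
  ; irrefl   = λ {A} {B} A≗B A∼B →
      ¬MeetInTwo-self (set A) (MeetInTwo-respʳ (set A) {set B} {set A} (λ p → sym (A≗B p)) A∼B)
  ; resp     = (λ {A} {B} {C} → MeetInTwo-respʳ (set A) {set B} {set C})
             , (λ {A} {B} {C} B≗C B∼A → MeetInTwo-sym {set A} {set C}
                  (MeetInTwo-respʳ (set A) {set B} {set C} B≗C (MeetInTwo-sym {set B} {set A} B∼A)))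
  }

{-# OPTIONS --safe #-}

-- Both graphs are described by one graph on the flags (v , s) with v , s ∈ 𝔽₂⁴,
-- v ≠ 0 and s ⊥ v, where (v , s) and (u , r) are adjacent when v ≠ u and
-- s·u = r·v.
--
-- Even words modulo 𝟏 form Λ²(𝔽₂⁴), half the weight being the Klein quadratic
-- form q. Points are non-adjacent when q vanishes on their difference, so an
-- independent set of size 8 is a coset of a maximal totally singular subspace;
-- by the Klein correspondence these are the kernels of x ↦ x ∧ v, and of the
-- same maps after dualising. The coset { x : x ∧ v = s } gives the flag
-- (v , s), and two cosets of one family meet in two points exactly when v ≠ u
-- and s·u = r·v, because x ∧ v ∧ u is both s·u and r·v. A transposition acts on
-- Λ² as a reflection and exchanges the two families, so the orbit of a coset
-- under translations and even permutations is its family.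
--
-- The Pauli group L is Λ²(𝔽₂⁴) as well, the stabiliser of a line of E₈ being
-- the kernel of x ↦ x ∧ v for the direction v of its orbit. A line obtained by
-- applying x to a fixed line of direction v has the flag (v , x ∧ v), and for
-- v ≠ u orthogonality of the lines (v , s) and (u , r) is s·u + r·v plus a
-- constant depending on v and u only. Comparing with wᵢ and wⱼ removes the
-- constant.

module Submission where

open import Defs
open import Algebra.Properties.CommutativeSemigroup using (interchange)
open import Data.Bool.Base using (Bool; true; false; not; _∧_; _∨_; T; if_then_else_)
open import Data.Bool.Properties using (T?; T-∧; T-∨; not-involutive)
open import Data.Fin.Base using (Fin; zero; suc; punchOut) renaming (_<_ to _<ᶠ_)
open import Data.Fin.Patterns using (0F; 1F; 2F; 3F; 4F; 5F; 6F; 7F)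
open import Data.Fin.Permutation as Perm using (Permutation′; _⟨$⟩ˡ_; _⟨$⟩ʳ_)
open import Data.Fin.Permutation.Transposition.List using (eval)
open import Data.Fin.Properties using (injective⇒≤; punchOut-injective; ¬∀⟶∃¬; _<?_) renaming (_≟_ to _≟ᶠ_; all? to allFin?; any? to anyFin?)
open import Data.Integer.Base using (ℤ; 0ℤ; 1ℤ; -1ℤ; -_) renaming (_+_ to _+ᶻ_; _*_ to _*ᶻ_)
open import Data.List.Base using (List; []; _∷_; _++_; length; filter; lookup) renaming (map to mapᴸ)
open import Data.List.Membership.Propositional using () renaming (_∈_ to _∈ᴸ_)
open import Data.List.Membership.Propositional.Properties using (∈-map⁺; ∈-map⁻; ∈-++⁺ˡ; ∈-++⁺ʳ; ∈-filter⁺; ∈-filter⁻; ∈-lookup)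
open import Data.List.Relation.Unary.All as All using (All; []; _∷_)
open import Data.List.Relation.Unary.AllPairs using ([]; _∷_)
open import Data.List.Relation.Unary.Any as Any using (here; there)
open import Data.List.Relation.Unary.Any.Properties using (lookup-index)
open import Data.List.Relation.Unary.Unique.Propositional using (Unique)
open import Data.List.Relation.Unary.Unique.Propositional.Properties using (map⁺; ++⁺; filter⁺)
open import Data.Nat.Base using (ℕ; zero; suc) renaming (_*_ to _*ᴺ_)
open import Data.Nat.Divisibility using (_∣_; divides)
open import Data.Parity.Base using (Parity; 0ℙ; 1ℙ; _+_; _*_)
open import Data.Product.Base using (_×_; _,_; ∃-syntax; proj₁; proj₂)
open import Data.Sign.Base using (Sign) renaming (+ to ⊕ˢ; - to ⊖ˢ)
open import Data.Sum.Base using (_⊎_; inj₁; inj₂; [_,_]′)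
open import Data.Vec.Base as Vec using (Vec; []; _∷_; map; zipWith; replicate; tabulate; count; foldr′; _[_]≔_)
open import Data.Vec.Functional using (Vector)
open import Data.Vec.Properties using (≡-dec; zipWith-assoc; zipWith-comm; zipWith-identityˡ; zipWith-identityʳ; ∷-injectiveʳ; tabulate-cong; lookup∘tabulate; tabulate∘lookup)
open import Function.Base using (_∘_; id; case_of_)
open import Function.Bundles using (_⇔_; mk⇔; module Equivalence)
open import Function.Definitions using (Injective)
open import Level using (0ℓ)
open import Relation.Binary.Definitions using (DecidableEquality)
open import Relation.Binary.PropositionalEquality using (_≡_; _≢_; refl; sym; trans; cong; cong₂; subst; module ≡-Reasoning)
open import Relation.Nullary.Decidable using (Dec; yes; no; ⌊_⌋; map′; toWitness; fromWitness; ¬?; _×-dec_; _⊎-dec_; _→-dec_)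
open import Relation.Nullary.Negation using (¬_; contradiction)
open import Relation.Unary using (Pred; Decidable; _∈_; _∩_)
import Algebra.Properties.CommutativeMonoid.Sum as Sum
import Data.Bool.Properties as Bool
import Data.Integer.Properties as ℤ
import Data.Nat.Properties as ℕ
import Data.Parity.Properties as ℙ
import Function.Construct.Composition as Composition

open Sum ℙ.+-0-commutativeMonoid using () renaming (sum-permute to sumℙ-permute)
open ≡-Reasoning
open Equivalence using (to; from)

-- Linear algebra over 𝔽₂.

F : ℕ → Set
F n = Vec Parity n

infix 4 _≟_
infixl 6 _⊕_
infix 8 _·_

_≟_ : ∀ {n} → DecidableEquality (F n)
_≟_ = ≡-dec ℙ._≟_

_⊕_ : ∀ {n} → F n → F n → F n
_⊕_ = zipWith _+_

𝟎 : ∀ {n} → F n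
𝟎 = replicate _ 0ℙ

_·_ : ∀ {n} → F n → F n → Parity
[]      · []      = 0ℙ
(a ∷ x) · (b ∷ y) = (a * b) + (x · y)

⊕-assoc : ∀ {n} (x y z : F n) → (x ⊕ y) ⊕ z ≡ x ⊕ (y ⊕ z)
⊕-assoc = zipWith-assoc ℙ.+-assoc

⊕-comm : ∀ {n} (x y : F n) → x ⊕ y ≡ y ⊕ x
⊕-comm = zipWith-comm ℙ.+-comm

⊕-identityʳ : ∀ {n} (x : F n) → x ⊕ 𝟎 ≡ x
⊕-identityʳ = zipWith-identityʳ ℙ.+-identityʳ

⊕-self : ∀ {n} (x : F n) → x ⊕ x ≡ 𝟎
⊕-self []      = refl
⊕-self (a ∷ x) = cong₂ _∷_ (ℙ.p+p≡0ℙ a) (⊕-self x)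

⊕-cancelʳ : ∀ {n} (x y : F n) → (x ⊕ y) ⊕ y ≡ x
⊕-cancelʳ x y = begin
  (x ⊕ y) ⊕ y ≡⟨ ⊕-assoc x y y ⟩
  x ⊕ (y ⊕ y) ≡⟨ cong (x ⊕_) (⊕-self y) ⟩
  x ⊕ 𝟎       ≡⟨ ⊕-identityʳ x ⟩
  x           ∎

⊕-cancelˡ : ∀ {n} (x y : F n) → x ⊕ (x ⊕ y) ≡ y
⊕-cancelˡ x y = trans (⊕-comm x (x ⊕ y)) (trans (cong (_⊕ x) (⊕-comm x y)) (⊕-cancelʳ y x))

⊕-difference : ∀ {n} (x y z : F n) → (x ⊕ z) ⊕ (y ⊕ z) ≡ x ⊕ y
⊕-difference x y z = begin
  (x ⊕ z) ⊕ (y ⊕ z) ≡⟨ cong ((x ⊕ z) ⊕_) (⊕-comm y z) ⟩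
  (x ⊕ z) ⊕ (z ⊕ y) ≡⟨ ⊕-assoc (x ⊕ z) z y ⟨
  ((x ⊕ z) ⊕ z) ⊕ y ≡⟨ cong (_⊕ y) (⊕-cancelʳ x z) ⟩
  x ⊕ y             ∎

x⊕y≡z⇒x≡z⊕y : ∀ {n} (x y : F n) {z} → x ⊕ y ≡ z → x ≡ z ⊕ y
x⊕y≡z⇒x≡z⊕y x y refl = sym (⊕-cancelʳ x y)

x≡z⊕y⇒x⊕y≡z : ∀ {n} {x} (y z : F n) → x ≡ z ⊕ y → x ⊕ y ≡ z
x≡z⊕y⇒x⊕y≡z y z refl = ⊕-cancelʳ z y

⊕≡𝟎⇒≡ : ∀ {n} (x y : F n) → x ⊕ y ≡ 𝟎 → x ≡ y
⊕≡𝟎⇒≡ x y e = trans (x⊕y≡z⇒x≡z⊕y x y e) (zipWith-identityˡ ℙ.+-identityˡ y)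

·-comm : ∀ {n} (x y : F n) → x · y ≡ y · x
·-comm []      []      = refl
·-comm (a ∷ x) (b ∷ y) = cong₂ _+_ (ℙ.*-comm a b) (·-comm x y)

·-distribˡ-⊕ : ∀ {n} (x y z : F n) → x · (y ⊕ z) ≡ (x · y) + (x · z)
·-distribˡ-⊕ []      []      []      = refl
·-distribˡ-⊕ (a ∷ x) (b ∷ y) (c ∷ z) = begin
  (a * (b + c)) + (x · (y ⊕ z))             ≡⟨ cong₂ _+_ (ℙ.*-distribˡ-+ a b c) (·-distribˡ-⊕ x y z) ⟩
  ((a * b) + (a * c)) + ((x · y) + (x · z)) ≡⟨ interchange ℙ.+-commutativeSemigroup (a * b) (a * c) (x · y) (x · z) ⟩
  ((a * b) + (x · y)) + ((a * c) + (x · z)) ∎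

·-distribʳ-⊕ : ∀ {n} (x y z : F n) → (y ⊕ z) · x ≡ (y · x) + (z · x)
·-distribʳ-⊕ x y z = begin
  (y ⊕ z) · x       ≡⟨ ·-comm (y ⊕ z) x ⟩
  x · (y ⊕ z)       ≡⟨ ·-distribˡ-⊕ x y z ⟩
  (x · y) + (x · z) ≡⟨ cong₂ _+_ (·-comm x y) (·-comm x z) ⟩
  (y · x) + (z · x) ∎

infixr 7 _✶_

_✶_ : ∀ {m n} → Vec (F n) m → F n → F m
A ✶ x = map (_· x) A

✶-distrib-⊕ : ∀ {m n} (A : Vec (F n) m) x y → A ✶ (x ⊕ y) ≡ A ✶ x ⊕ A ✶ y
✶-distrib-⊕ []      x y = refl
✶-distrib-⊕ (a ∷ A) x y = cong₂ _∷_ (·-distribˡ-⊕ a x y) (✶-distrib-⊕ A x y)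

-- Decision by exhaustive search.

-- The truth value of a search is computed outside the Dec record, whose proof
-- field would otherwise keep all evaluated subproblems in memory.

allᵇ : ∀ {n} → (F n → Bool) → Bool
allᵇ {zero}  f = f []
allᵇ {suc n} f = allᵇ (f ∘ (0ℙ ∷_)) ∧ allᵇ (f ∘ (1ℙ ∷_))

allᵇ⁻ : ∀ {n} (f : F n → Bool) → T (allᵇ f) → ∀ x → T (f x)
allᵇ⁻ f t []       = t
allᵇ⁻ f t (0ℙ ∷ x) = allᵇ⁻ (f ∘ (0ℙ ∷_)) (proj₁ (Equivalence.to T-∧ t)) x
allᵇ⁻ f t (1ℙ ∷ x) = allᵇ⁻ (f ∘ (1ℙ ∷_)) (proj₂ (Equivalence.to (T-∧ {allᵇ (f ∘ (0ℙ ∷_))}) t)) x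

allᵇ⁺ : ∀ {n} (f : F n → Bool) → (∀ x → T (f x)) → T (allᵇ f)
allᵇ⁺ {zero}  f t = t []
allᵇ⁺ {suc n} f t = Equivalence.from T-∧ (allᵇ⁺ _ (t ∘ (0ℙ ∷_)) , allᵇ⁺ _ (t ∘ (1ℙ ∷_)))

all? : ∀ {n} {P : Pred (F n) 0ℓ} → Decidable P → Dec (∀ x → P x)
all? P? = map′ (λ t x → toWitness (allᵇ⁻ _ t x)) (λ p → allᵇ⁺ _ λ x → fromWitness (p x))
               (T? (allᵇ λ x → ⌊ P? x ⌋))

anyᵇ : ∀ {n} → (F n → Bool) → Bool
anyᵇ {zero}  f = f []
anyᵇ {suc n} f = anyᵇ (f ∘ (0ℙ ∷_)) ∨ anyᵇ (f ∘ (1ℙ ∷_))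

anyᵇ⁻ : ∀ {n} (f : F n → Bool) → T (anyᵇ f) → ∃[ x ] T (f x)
anyᵇ⁻ {zero}  f t = [] , t
anyᵇ⁻ {suc n} f t with Equivalence.to (T-∨ {anyᵇ (f ∘ (0ℙ ∷_))}) t
... | inj₁ l = let x , p = anyᵇ⁻ _ l in 0ℙ ∷ x , p
... | inj₂ r = let x , p = anyᵇ⁻ _ r in 1ℙ ∷ x , p

anyᵇ⁺ : ∀ {n} (f : F n → Bool) x → T (f x) → T (anyᵇ f)
anyᵇ⁺ f []       t = t
anyᵇ⁺ f (0ℙ ∷ x) t = Equivalence.from T-∨ (inj₁ (anyᵇ⁺ _ x t))
anyᵇ⁺ f (1ℙ ∷ x) t = Equivalence.from (T-∨ {anyᵇ (f ∘ (0ℙ ∷_))}) (inj₂ (anyᵇ⁺ _ x t))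

any? : ∀ {n} {P : Pred (F n) 0ℓ} → Decidable P → Dec (∃[ x ] P x)
any? P? = map′ (λ t → let x , p = anyᵇ⁻ _ t in x , toWitness p) (λ (x , p) → anyᵇ⁺ _ x (fromWitness p))
               (T? (anyᵇ λ x → ⌊ P? x ⌋))

allBool? : {P : Pred Bool 0ℓ} → Decidable P → Dec (∀ b → P b)
allBool? P? = map′ (λ { (f , t) false → f ; (f , t) true → t }) (λ p → p false , p true) (P? false ×-dec P? true)

allℙ? : {P : Pred Parity 0ℓ} → Decidable P → Dec (∀ a → P a)
allℙ? P? = map′ (λ { (p , q) 0ℙ → p ; (p , q) 1ℙ → q }) (λ p → p 0ℙ , p 1ℙ) (P? 0ℙ ×-dec P? 1ℙ)

allSign? : {P : Pred Sign 0ℓ} → Decidable P → Dec (∀ s → P s)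
allSign? P? = map′ (λ { (p , q) ⊕ˢ → p ; (p , q) ⊖ˢ → q }) (λ p → p ⊕ˢ , p ⊖ˢ) (P? ⊕ˢ ×-dec P? ⊖ˢ)

anySign? : {P : Pred Sign 0ℓ} → Decidable P → Dec (∃[ s ] P s)
anySign? P? = map′ [ (⊕ˢ ,_) , (⊖ˢ ,_) ]′ (λ { (⊕ˢ , p) → inj₁ p ; (⊖ˢ , p) → inj₂ p }) (P? ⊕ˢ ⊎-dec P? ⊖ˢ)

-- Bivectors of 𝔽₂⁴ and the Klein correspondence.

-- A vector (a , b) of 𝔽₂³ × 𝔽₂³ is the bivector with x₀ᵢ = aᵢ and xⱼₖ = bᵢ
-- ({ i , j , k } = { 1 , 2 , 3 }), and rows false v is the matrix of
-- x ↦ x ∧ v = (b·v′ , v₀ b + a × v′), v = (v₀ , v′). The second family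
-- exchanges a and b.
rows : Bool → F 4 → Vec (F 6) 4
rows false (s ∷ t ∷ u ∷ v ∷ []) =
    (0ℙ ∷ 0ℙ ∷ 0ℙ ∷ t  ∷ u  ∷ v  ∷ [])
  ∷ (0ℙ ∷ v  ∷ u  ∷ s  ∷ 0ℙ ∷ 0ℙ ∷ [])
  ∷ (v  ∷ 0ℙ ∷ t  ∷ 0ℙ ∷ s  ∷ 0ℙ ∷ [])
  ∷ (u  ∷ t  ∷ 0ℙ ∷ 0ℙ ∷ 0ℙ ∷ s  ∷ [])
  ∷ []
rows true (s ∷ t ∷ u ∷ v ∷ []) =
    (t  ∷ u  ∷ v  ∷ 0ℙ ∷ 0ℙ ∷ 0ℙ ∷ [])
  ∷ (s  ∷ 0ℙ ∷ 0ℙ ∷ 0ℙ ∷ v  ∷ u  ∷ [])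
  ∷ (0ℙ ∷ s  ∷ 0ℙ ∷ v  ∷ 0ℙ ∷ t  ∷ [])
  ∷ (0ℙ ∷ 0ℙ ∷ s  ∷ u  ∷ t  ∷ 0ℙ ∷ [])
  ∷ []

opaque
  syn : Bool → F 4 → F 6 → F 4
  syn ε v x = rows ε v ✶ x

  -- The Pfaffian x₀₁x₂₃ + x₀₂x₁₃ + x₀₃x₁₂.
  quad : F 6 → Parity
  quad (a ∷ b ∷ c ∷ d ∷ e ∷ f ∷ []) = (a * d) + (b * e) + (c * f)

  -- `polar x · y` is the polarisation of `quad`, the coefficient of `x ∧ y`.
  polar : F 6 → F 6
  polar (a ∷ b ∷ c ∷ d ∷ e ∷ f ∷ []) = d ∷ e ∷ f ∷ a ∷ b ∷ c ∷ []

  reflect : F 6 → F 6 → F 6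
  reflect r x = x ⊕ map ((polar r · x) *_) r

  syn-⊕ : ∀ ε v x y → syn ε v (x ⊕ y) ≡ syn ε v x ⊕ syn ε v y
  syn-⊕ ε v = ✶-distrib-⊕ (rows ε v)

Singular : F 6 → Set
Singular x = quad x ≡ 0ℙ

singular? : Decidable Singular
singular? x = quad x ℙ.≟ 0ℙ

syn-difference : ∀ ε v x y → syn ε v x ≡ syn ε v y → syn ε v (x ⊕ y) ≡ 𝟎
syn-difference ε v x y e = begin
  syn ε v (x ⊕ y)         ≡⟨ syn-⊕ ε v x y ⟩
  syn ε v x ⊕ syn ε v y   ≡⟨ cong (_⊕ syn ε v y) e ⟩
  syn ε v y ⊕ syn ε v y   ≡⟨ ⊕-self (syn ε v y) ⟩
  𝟎                       ∎

syn-difference⁻ : ∀ ε v x y → syn ε v (x ⊕ y) ≡ 𝟎 → syn ε v x ≡ syn ε v y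
syn-difference⁻ ε v x y e = ⊕≡𝟎⇒≡ _ _ (trans (sym (syn-⊕ ε v x y)) e)

opaque
  unfolding syn

  syn-⊥ : ∀ ε v x → syn ε v x · v ≡ 0ℙ
  syn-⊥ = toWitness {a? = allBool? λ ε → all? λ v → all? λ x → syn ε v x · v ℙ.≟ 0ℙ} _

  syn-symmetric : ∀ ε v u x → syn ε v x · u ≡ syn ε u x · v
  syn-symmetric = toWitness {a? = allBool? λ ε → all? λ v → all? λ u → all? λ x →
    syn ε v x · u ℙ.≟ syn ε u x · v} _

  -- Rank and nullity of `syn ε v` are both 3, so the image fills the hyperplane in which `syn-⊥`
  -- places it.
  syn-onto : ∀ ε v → v ≢ 𝟎 → ∀ s → s · v ≡ 0ℙ → ∃[ x ] syn ε v x ≡ s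
  syn-onto = toWitness {a? = allBool? λ ε → all? λ v → ¬? (v ≟ 𝟎) →-dec
    all? λ s → (s · v ℙ.≟ 0ℙ) →-dec any? λ x → syn ε v x ≟ s} _

  -- `x ∧ v` vanishes only for `x` of the form `v ∧ y`, and a decomposable bivector has zero
  -- Pfaffian. Dualising preserves the Pfaffian.
  kernel-singular : ∀ ε v → v ≢ 𝟎 → ∀ x → syn ε v x ≡ 𝟎 → Singular x
  kernel-singular = toWitness {a? = allBool? λ ε → all? λ v → ¬? (v ≟ 𝟎) →-dec
    all? λ x → (syn ε v x ≟ 𝟎) →-dec singular? x} _

  -- The 30 maximal totally singular subspaces are distinct and of equal dimension, so inclusion
  -- forces equality. Hence a coset determines its family and direction.
  kernel⊆kernel : ∀ ε ε′ v → v ≢ 𝟎 → ∀ u → u ≢ 𝟎 → (∀ x → syn ε v x ≡ 𝟎 → syn ε′ u x ≡ 𝟎) → ε ≡ ε′ × v ≡ u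
  kernel⊆kernel = toWitness {a? = allBool? λ ε → allBool? λ ε′ → all? λ v → ¬? (v ≟ 𝟎) →-dec
    all? λ u → ¬? (u ≟ 𝟎) →-dec all? (λ x → (syn ε v x ≟ 𝟎) →-dec (syn ε′ u x ≟ 𝟎)) →-dec
    (ε Bool.≟ ε′ ×-dec v ≟ u)} _

  -- Up to duality the kernels are `v ∧ 𝔽₂⁴` and `u ∧ 𝔽₂⁴`, and the witness `h` is `v ∧ u`.
  kernel∩kernel : ∀ ε v → v ≢ 𝟎 → ∀ u → u ≢ 𝟎 → v ≢ u →
    ∃[ h ] h ≢ 𝟎 × syn ε v h ≡ 𝟎 × syn ε u h ≡ 𝟎 × (∀ x → syn ε v x ≡ 𝟎 → syn ε u x ≡ 𝟎 → x ≡ 𝟎 ⊎ x ≡ h)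
  kernel∩kernel = toWitness {a? = allBool? λ ε → all? λ v → ¬? (v ≟ 𝟎) →-dec
    all? λ u → ¬? (u ≟ 𝟎) →-dec ¬? (v ≟ u) →-dec any? λ h → ¬? (h ≟ 𝟎) ×-dec
    syn ε v h ≟ 𝟎 ×-dec syn ε u h ≟ 𝟎 ×-dec
    all? λ x → (syn ε v x ≟ 𝟎) →-dec (syn ε u x ≟ 𝟎) →-dec (x ≟ 𝟎 ⊎-dec x ≟ h)} _

  -- A kernel element `v ∧ y` has image `v ∧ y ∧ u`, and these fill the covectors vanishing on both
  -- `v` and `u`.
  syn-onto-kernel : ∀ ε v → v ≢ 𝟎 → ∀ u → u ≢ 𝟎 → v ≢ u → ∀ r → r · u ≡ 0ℙ → r · v ≡ 0ℙ →
    ∃[ x ] syn ε v x ≡ 𝟎 × syn ε u x ≡ r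
  syn-onto-kernel = toWitness {a? = allBool? λ ε → all? λ v → ¬? (v ≟ 𝟎) →-dec
    all? λ u → ¬? (u ≟ 𝟎) →-dec ¬? (v ≟ u) →-dec all? λ r → (r · u ℙ.≟ 0ℙ) →-dec (r · v ℙ.≟ 0ℙ) →-dec
    any? λ x → syn ε v x ≟ 𝟎 ×-dec syn ε u x ≟ r} _

  -- The span of a and b lies in exactly one maximal totally singular subspace of
  -- each family, and these two contain all singular vectors orthogonal to a and b.
  singular-pair : ∀ a → Singular a → a ≢ 𝟎 → ∀ b → Singular b → Singular (a ⊕ b) → b ≢ 𝟎 → a ≢ b →
    ∃[ v ] v ≢ 𝟎 × syn false v a ≡ 𝟎 × syn false v b ≡ 𝟎 ×
    ∃[ u ] u ≢ 𝟎 × syn true u a ≡ 𝟎 × syn true u b ≡ 𝟎 × v · u ≡ 0ℙ ×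
    (∀ x → Singular x → Singular (x ⊕ a) → Singular (x ⊕ b) → syn false v x ≡ 𝟎 ⊎ syn true u x ≡ 𝟎)
  singular-pair = toWitness {a? = all? λ a → singular? a →-dec ¬? (a ≟ 𝟎) →-dec
    all? λ b → singular? b →-dec singular? (a ⊕ b) →-dec ¬? (b ≟ 𝟎) →-dec ¬? (a ≟ b) →-dec
    any? λ v → ¬? (v ≟ 𝟎) ×-dec syn false v a ≟ 𝟎 ×-dec syn false v b ≟ 𝟎 ×-dec
    any? λ u → ¬? (u ≟ 𝟎) ×-dec syn true u a ≟ 𝟎 ×-dec syn true u b ≟ 𝟎 ×-dec v · u ℙ.≟ 0ℙ ×-dec
    all? λ x → singular? x →-dec singular? (x ⊕ a) →-dec singular? (x ⊕ b) →-dec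
    (syn false v x ≟ 𝟎 ⊎-dec syn true u x ≟ 𝟎)} _

  -- For nonzero orthogonal `v` and `u` the kernels meet in a totally singular plane. If both
  -- alternatives failed, this plane together with `x` and `y` would span a totally singular space
  -- of dimension 4, while the maximum is 3.
  opposite-kernels : ∀ v u → v · u ≡ 0ℙ → ∀ x → syn false v x ≡ 𝟎 → ∀ y → syn true u y ≡ 𝟎 →
    Singular (x ⊕ y) → syn true u x ≡ 𝟎 ⊎ syn false v y ≡ 𝟎
  opposite-kernels = toWitness {a? = all? λ v → all? λ u → (v · u ℙ.≟ 0ℙ) →-dec
    all? λ x → (syn false v x ≟ 𝟎) →-dec all? λ y → (syn true u y ≟ 𝟎) →-dec
    singular? (x ⊕ y) →-dec (syn true u x ≟ 𝟎 ⊎-dec syn false v y ≟ 𝟎)} _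

  -- With R and R̃ the alternating matrices of r and of its dual, R R̃ = quad r;
  -- this is the polarisation R X̃ + X R̃ = polar r · x applied to v.
  syn-reflect : ∀ ε r → quad r ≡ 1ℙ → ∀ v x → syn (not ε) (syn ε v (reflect r x)) r ≡ syn (not ε) (syn ε v r) x
  syn-reflect = toWitness {a? = allBool? λ ε → all? λ r → (quad r ℙ.≟ 1ℙ) →-dec all? λ v → all? λ x →
    syn (not ε) (syn ε v (reflect r x)) r ≟ syn (not ε) (syn ε v r) x} _

  -- This is `R R̃ = quad r` with `quad r` equal to one: the two matrices of `r` are inverse to each
  -- other.
  syn-involutive : ∀ ε r → quad r ≡ 1ℙ → ∀ v → syn (not ε) (syn ε v r) r ≡ v
  syn-involutive = toWitness {a? = allBool? λ ε → all? λ r → (quad r ℙ.≟ 1ℙ) →-dec all? λ v →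
    syn (not ε) (syn ε v r) r ≟ v} _

  -- A single nonsingular `r` exchanges the families, so a move inside one family takes two.
  syn-transitive : ∀ ε v → v ≢ 𝟎 → ∀ u → u ≢ 𝟎 →
    ∃[ r ] quad r ≡ 1ℙ × ∃[ r′ ] quad r′ ≡ 1ℙ × syn (not ε) (syn ε v r) r′ ≡ u
  syn-transitive = toWitness {a? = allBool? λ ε → all? λ v → ¬? (v ≟ 𝟎) →-dec all? λ u → ¬? (u ≟ 𝟎) →-dec
    any? λ r → quad r ℙ.≟ 1ℙ ×-dec any? λ r′ → quad r′ ℙ.≟ 1ℙ ×-dec syn (not ε) (syn ε v r) r′ ≟ u} _

  syn-𝟎ˡ : ∀ ε x → syn ε 𝟎 x ≡ 𝟎
  syn-𝟎ˡ = toWitness {a? = allBool? λ ε → all? λ x → syn ε 𝟎 x ≟ 𝟎} _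

syn-· : ∀ ε r → quad r ≡ 1ℙ → ∀ v s → syn (not ε) s r · syn ε v r ≡ s · v
syn-· ε r q v s = begin
  syn (not ε) s r · syn ε v r   ≡⟨ syn-symmetric (not ε) s (syn ε v r) r ⟩
  syn (not ε) (syn ε v r) r · s ≡⟨ cong (_· s) (syn-involutive ε r q v) ⟩
  v · s                         ≡⟨ ·-comm v s ⟩
  s · v                         ∎

syn-≢𝟎 : ∀ ε r → quad r ≡ 1ℙ → ∀ v → v ≢ 𝟎 → syn ε v r ≢ 𝟎
syn-≢𝟎 ε r q v v≢0 e = v≢0 (begin
  v                         ≡⟨ syn-involutive ε r q v ⟨
  syn (not ε) (syn ε v r) r ≡⟨ cong (λ u → syn (not ε) u r) e ⟩
  syn (not ε) 𝟎 r           ≡⟨ syn-𝟎ˡ (not ε) r ⟩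
  𝟎                         ∎)

-- Finite counting and the enumeration of cosets.

injective⇒surjective : ∀ {n} {f : Fin n → Fin n} → Injective _≡_ _≡_ f → ∀ j → ∃[ i ] f i ≡ j
injective⇒surjective {suc n} {f} f-inj j with anyFin? (λ i → f i ≟ᶠ j)
... | yes fi≡j = fi≡j
... | no  ∄i   = contradiction
  (injective⇒≤ {f = λ i → punchOut (j≢f i)} (λ {k} {l} eq → f-inj (punchOut-injective (j≢f k) (j≢f l) eq))) ℕ.1+n≰n
  where
  j≢f : ∀ i → j ≢ f i
  j≢f i j≡fi = ∄i (i , sym j≡fi)

lookup-injective : ∀ {A : Set} {xs : List A} → Unique xs → Injective _≡_ _≡_ (lookup xs)
lookup-injective (x∉ ∷ _)  {zero}  {zero}  _  = refl
lookup-injective (x∉ ∷ _)  {zero}  {suc j} eq = contradiction eq (All.lookup x∉ (∈-lookup j))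
lookup-injective (x∉ ∷ _)  {suc i} {zero}  eq = contradiction (sym eq) (All.lookup x∉ (∈-lookup i))
lookup-injective (_ ∷ uxs) {suc i} {suc j} eq = cong suc (lookup-injective uxs eq)

-- Serves to turn an inclusion between sets of equal size into an equality: eight points inside a
-- coset, and fifteen orbits inside the nonzero directions.
injective⇒exhaustive : ∀ {A : Set} {n} {xs : List A} → length xs ≡ n → {f : Fin n → A} → Injective _≡_ _≡_ f →
                       (∀ i → f i ∈ᴸ xs) → ∀ {x} → x ∈ᴸ xs → ∃[ i ] x ≡ f i
injective⇒exhaustive {xs = xs} refl {f} f-inj f∈xs {x} x∈xs = i , (begin
  x                              ≡⟨ lookup-index x∈xs ⟩
  lookup xs (Any.index x∈xs)     ≡⟨ cong (lookup xs) eq ⟨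
  lookup xs (Any.index (f∈xs i)) ≡⟨ lookup-index (f∈xs i) ⟨
  f i                            ∎)
  where
  position-injective : Injective _≡_ _≡_ (Any.index ∘ f∈xs)
  position-injective {i} {j} eq =
    f-inj (trans (lookup-index (f∈xs i)) (trans (cong (lookup xs) eq) (sym (lookup-index (f∈xs j)))))

  preimage = injective⇒surjective position-injective (Any.index x∈xs)
  i  = proj₁ preimage
  eq = proj₂ preimage

vectors : ∀ n → List (F n)
vectors zero    = [] ∷ []
vectors (suc n) = mapᴸ (0ℙ ∷_) (vectors n) ++ mapᴸ (1ℙ ∷_) (vectors n)

∈-vectors : ∀ {n} (x : F n) → x ∈ᴸ vectors n
∈-vectors []       = here refl
∈-vectors (0ℙ ∷ x) = ∈-++⁺ˡ (∈-map⁺ _ (∈-vectors x))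
∈-vectors (1ℙ ∷ x) = ∈-++⁺ʳ _ (∈-map⁺ _ (∈-vectors x))

vectors-unique : ∀ n → Unique (vectors n)
vectors-unique zero    = [] ∷ []
vectors-unique (suc n) = ++⁺ (map⁺ ∷-injectiveʳ (vectors-unique n)) (map⁺ ∷-injectiveʳ (vectors-unique n))
  λ (x∈₀ , x∈₁) → case ∈-map⁻ _ x∈₀ , ∈-map⁻ _ x∈₁ of λ { ((_ , _ , refl) , (_ , _ , ())) }

opaque
  coset : Bool → F 4 → F 4 → List (F 6)
  coset ε v s = filter (λ x → syn ε v x ≟ s) (vectors 6)

  ∈-coset : ∀ ε v s {x} → x ∈ᴸ coset ε v s ⇔ syn ε v x ≡ s
  ∈-coset ε v s = mk⇔ (proj₂ ∘ ∈-filter⁻ (λ x → syn ε v x ≟ s) {xs = vectors 6})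
                      (∈-filter⁺ (λ x → syn ε v x ≟ s) (∈-vectors _))

  coset-unique : ∀ ε v s → Unique (coset ε v s)
  coset-unique ε v s = filter⁺ (λ x → syn ε v x ≟ s) (vectors-unique 6)

opaque
  unfolding syn coset

  length-coset : ∀ ε v → v ≢ 𝟎 → ∀ s → s · v ≡ 0ℙ → length (coset ε v s) ≡ 8
  length-coset = toWitness {a? = allBool? λ ε → all? λ v → ¬? (v ≟ 𝟎) →-dec all? λ s → (s · v ℙ.≟ 0ℙ) →-dec
    (length (coset ε v s) ℕ.≟ 8)} _

-- Points of the folded halved cube as bivectors.

total : ∀ {n} → F n → Parity
total = foldr′ _+_ 0ℙ

𝟙 : ∀ {n} → F n
𝟙 = replicate _ 1ℙ

wt : ∀ {n} → F n → ℕ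
wt = count (λ a → ¬? (a ℙ.≟ 0ℙ))

-- These words span the even words modulo 𝟏. They have weight 4, and the i-th
-- word has odd intersection with the (i + 3)-rd one only, so half the weight
-- becomes quad.
encoder : Vec (F 8) 6
encoder =
    (1ℙ ∷ 1ℙ ∷ 1ℙ ∷ 0ℙ ∷ 0ℙ ∷ 0ℙ ∷ 0ℙ ∷ 1ℙ ∷ [])
  ∷ (0ℙ ∷ 1ℙ ∷ 1ℙ ∷ 0ℙ ∷ 1ℙ ∷ 1ℙ ∷ 0ℙ ∷ 0ℙ ∷ [])
  ∷ (1ℙ ∷ 0ℙ ∷ 1ℙ ∷ 0ℙ ∷ 0ℙ ∷ 1ℙ ∷ 1ℙ ∷ 0ℙ ∷ [])
  ∷ (0ℙ ∷ 0ℙ ∷ 0ℙ ∷ 0ℙ ∷ 1ℙ ∷ 1ℙ ∷ 1ℙ ∷ 1ℙ ∷ [])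
  ∷ (0ℙ ∷ 0ℙ ∷ 1ℙ ∷ 1ℙ ∷ 0ℙ ∷ 0ℙ ∷ 1ℙ ∷ 1ℙ ∷ [])
  ∷ (0ℙ ∷ 1ℙ ∷ 0ℙ ∷ 1ℙ ∷ 0ℙ ∷ 1ℙ ∷ 0ℙ ∷ 1ℙ ∷ [])
  ∷ []

opaque
  enc : F 8 → F 6
  enc x = encoder ✶ x

  enc-⊕ : ∀ x y → enc (x ⊕ y) ≡ enc x ⊕ enc y
  enc-⊕ = ✶-distrib-⊕ encoder

unit : ∀ {n} → Fin n → F n
unit i = 𝟎 [ i ]≔ 1ℙ

root : Fin 8 → Fin 8 → F 6
root i j = enc (unit i ⊕ unit j)

opaque
  unfolding enc syn

  enc-𝟙 : enc 𝟙 ≡ 𝟎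
  enc-𝟙 = refl

  enc-onto : ∀ x → ∃[ y ] total y ≡ 0ℙ × enc y ≡ x
  enc-onto = toWitness {a? = all? λ x → any? λ y → total y ℙ.≟ 0ℙ ×-dec enc y ≟ x} _

  enc-kernel : ∀ y → total y ≡ 0ℙ → enc y ≡ 𝟎 → y ≡ 𝟎 ⊎ y ≡ 𝟙
  enc-kernel = toWitness {a? = all? λ y → (total y ℙ.≟ 0ℙ) →-dec (enc y ≟ 𝟎) →-dec (y ≟ 𝟎 ⊎-dec y ≟ 𝟙)} _

  -- Half the weight is odd exactly at weights 2 and 6, and adding `𝟙` turns 6 into 2.
  quad-enc : ∀ y → total y ≡ 0ℙ → quad (enc y) ≡ 1ℙ → wt y ≡ 2 ⊎ wt (y ⊕ 𝟙) ≡ 2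
  quad-enc = toWitness {a? = all? λ y → (total y ℙ.≟ 0ℙ) →-dec (quad (enc y) ℙ.≟ 1ℙ) →-dec
    (wt y ℕ.≟ 2 ⊎-dec wt (y ⊕ 𝟙) ℕ.≟ 2)} _

  quad-enc⁻ : ∀ y → total y ≡ 0ℙ → wt y ≡ 2 ⊎ wt (y ⊕ 𝟙) ≡ 2 → quad (enc y) ≡ 1ℙ
  quad-enc⁻ = toWitness {a? = all? λ y → (total y ℙ.≟ 0ℙ) →-dec (wt y ℕ.≟ 2 ⊎-dec wt (y ⊕ 𝟙) ℕ.≟ 2) →-dec
    (quad (enc y) ℙ.≟ 1ℙ)} _

  -- Swapping `i` and `j` adds `unit i ⊕ unit j` exactly when `y` meets that word oddly, and the
  -- parity of the intersection is the polar form.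
  enc-transpose : ∀ i j → i ≢ j → ∀ y → total y ≡ 0ℙ →
    enc (tabulate λ k → Vec.lookup y (Perm.transpose i j ⟨$⟩ˡ k)) ≡ reflect (root i j) (enc y)
  enc-transpose = toWitness {a? = allFin? λ i → allFin? λ j → ¬? (i ≟ᶠ j) →-dec all? λ y → (total y ℙ.≟ 0ℙ) →-dec
    (enc (tabulate λ k → Vec.lookup y (Perm.transpose i j ⟨$⟩ˡ k)) ≟ reflect (root i j) (enc y))} _

  quad-root : ∀ i j → i ≢ j → quad (root i j) ≡ 1ℙ
  quad-root = toWitness {a? = allFin? λ i → allFin? λ j → ¬? (i ≟ᶠ j) →-dec (quad (root i j) ℙ.≟ 1ℙ)} _

  -- There are 28 nonsingular vectors and 28 pairs of coordinates.
  quad-root⁻ : ∀ r → quad r ≡ 1ℙ → ∃[ i ] ∃[ j ] i ≢ j × root i j ≡ r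
  quad-root⁻ = toWitness {a? = all? λ r → (quad r ℙ.≟ 1ℙ) →-dec anyFin? λ i → anyFin? λ j → ¬? (i ≟ᶠ j) ×-dec root i j ≟ r} _

tabulate-⊞ᵥ : ∀ {n} (x y : Vector Parity n) → tabulate (x ⊞ᵥ y) ≡ tabulate x ⊕ tabulate y
tabulate-⊞ᵥ {zero}  x y = refl
tabulate-⊞ᵥ {suc n} x y = cong (x zero + y zero ∷_) (tabulate-⊞ᵥ (x ∘ suc) (y ∘ suc))

tabulate-injective : ∀ {A : Set} {n} {x y : Vector A n} → tabulate x ≡ tabulate y → ∀ k → x k ≡ y k
tabulate-injective {x = x} {y} eq k = begin
  x k                       ≡⟨ lookup∘tabulate x k ⟨
  Vec.lookup (tabulate x) k ≡⟨ cong (λ z → Vec.lookup z k) eq ⟩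
  Vec.lookup (tabulate y) k ≡⟨ lookup∘tabulate y k ⟩
  y k                       ∎

code : Point → F 6
code p = enc (tabulate (coords p))

code-translation : ∀ c p → code (act (translation c) p) ≡ code c ⊕ code p
code-translation c p = trans (cong enc (tabulate-⊞ᵥ (coords c) (coords p))) (enc-⊕ _ _)

≈₁⇒code≡ : ∀ {p q} → p ≈₁ q → code p ≡ code q
≈₁⇒code≡         (inj₁ e) = cong enc (tabulate-cong e)
≈₁⇒code≡ {p} {q} (inj₂ e) = begin
  code p                            ≡⟨ cong enc (tabulate-cong e) ⟩
  enc (tabulate (𝟏 ⊞ᵥ coords q))    ≡⟨ cong enc (tabulate-⊞ᵥ 𝟏 (coords q)) ⟩
  enc (𝟙 ⊕ tabulate (coords q))     ≡⟨ enc-⊕ 𝟙 (tabulate (coords q)) ⟩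
  enc 𝟙 ⊕ code q                    ≡⟨ cong (_⊕ code q) enc-𝟙 ⟩
  𝟎 ⊕ code q                        ≡⟨ zipWith-identityˡ ℙ.+-identityˡ (code q) ⟩
  code q                            ∎

code≡⇒≈₁ : ∀ {p q} → code p ≡ code q → p ≈₁ q
code≡⇒≈₁ {p} {q} eq = [ inj₁ ∘ same , inj₂ ∘ opposite ]′
  (enc-kernel (tabulate (coords p ⊞ᵥ coords q)) (even (act (translation p) q))
    (trans (code-translation p q) (trans (cong (_⊕ code q) eq) (⊕-self (code q)))))
  where
  sum≡ = tabulate-⊞ᵥ (coords p) (coords q)

  same : tabulate (coords p ⊞ᵥ coords q) ≡ 𝟎 → ∀ k → coords p k ≡ coords q k
  same e = tabulate-injective (⊕≡𝟎⇒≡ _ _ (trans (sym sum≡) e))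

  opposite : tabulate (coords p ⊞ᵥ coords q) ≡ 𝟙 → ∀ k → coords p k ≡ 1ℙ + coords q k
  opposite e = tabulate-injective (trans (x⊕y≡z⇒x≡z⊕y _ _ (trans (sym sum≡) e)) (sym (tabulate-⊞ᵥ 𝟏 (coords q))))

point : F 6 → Point
point x with y , even-y , _ ← enc-onto x = record
  { coords = Vec.lookup y
  ; even   = trans (cong total (tabulate∘lookup y)) even-y
  }

code-point : ∀ x → code (point x) ≡ x
code-point x with y , _ , enc-y ← enc-onto x = trans (cong enc (tabulate∘lookup y)) enc-y

private
  sum-𝟏 : ∀ (p q : Point) → tabulate (coords p ⊞ᵥ coords q ⊞ᵥ 𝟏) ≡ tabulate (coords p ⊞ᵥ coords q) ⊕ 𝟙
  sum-𝟏 p q = tabulate-⊞ᵥ (coords p ⊞ᵥ coords q) 𝟏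

Adjacent⇒ : ∀ p q → Adjacent p q → quad (code p ⊕ code q) ≡ 1ℙ
Adjacent⇒ p q adj = trans (cong quad (sym (code-translation p q)))
  (quad-enc⁻ (tabulate (coords p ⊞ᵥ coords q)) (even (act (translation p) q))
    ([ inj₁ , (λ e → inj₂ (trans (cong wt (sym (sum-𝟏 p q))) e)) ]′ adj))

⇒Adjacent : ∀ p q → quad (code p ⊕ code q) ≡ 1ℙ → Adjacent p q
⇒Adjacent p q e = [ inj₁ , (λ w → inj₂ (trans (cong wt (sum-𝟏 p q)) w)) ]′
  (quad-enc (tabulate (coords p ⊞ᵥ coords q)) (even (act (translation p) q)) (trans (cong quad (code-translation p q)) e))

enumerated : ∀ {L : List (F 6)} {n} {P : Pred Point 0ℓ} → Unique L → length L ≡ n →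
             (∀ p → P p ⇔ code p ∈ᴸ L) → HasSize P n
enumerated {L} uniq refl P⇔ = f , f-injective , λ p → mk⇔ (locate p ∘ to (P⇔ p)) (from (P⇔ p) ∘ unlocate p)
  where
  f : Fin (length L) → Point
  f i = point (lookup L i)

  code-f : ∀ i → code (f i) ≡ lookup L i
  code-f i = code-point (lookup L i)

  f-injective : ∀ {i j} → f i ≈₁ f j → i ≡ j
  f-injective {i} {j} e = lookup-injective uniq (trans (sym (code-f i)) (trans (≈₁⇒code≡ {f i} {f j} e) (code-f j)))

  locate : ∀ p → code p ∈ᴸ L → ∃[ i ] p ≈₁ f i
  locate p p∈L = Any.index p∈L , code≡⇒≈₁ {p} {f (Any.index p∈L)} (trans (lookup-index p∈L) (sym (code-f (Any.index p∈L))))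

  unlocate : ∀ p → (∃[ i ] p ≈₁ f i) → code p ∈ᴸ L
  unlocate p (i , e) = subst (_∈ᴸ L) (sym (trans (≈₁⇒code≡ {p} {f i} e) (code-f i))) (∈-lookup i)

-- Cosets as independent sets.

T-ext : ∀ {a b} → (T a → T b) → (T b → T a) → a ≡ b
T-ext {false} {false} f g = refl
T-ext {false} {true}  f g = contradiction (g _) id
T-ext {true}  {false} f g = contradiction (f _) id
T-ext {true}  {true}  f g = refl

inCoset : Bool → F 4 → F 4 → Point → Bool
inCoset ε v s p = ⌊ syn ε v (code p) ≟ s ⌋

inCoset-cong : ∀ ε v s p ε′ v′ s′ p′ → (syn ε v (code p) ≡ s → syn ε′ v′ (code p′) ≡ s′) →
               (syn ε′ v′ (code p′) ≡ s′ → syn ε v (code p) ≡ s) → inCoset ε v s p ≡ inCoset ε′ v′ s′ p′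
inCoset-cong ε v s p ε′ v′ s′ p′ f g = T-ext (fromWitness ∘ f ∘ toWitness) (fromWitness ∘ g ∘ toWitness)

record Flag : Set where
  constructor flag
  field
    dir      : F 4
    dir≢𝟎    : dir ≢ 𝟎
    syndrome : F 4
    incident : syndrome · dir ≡ 0ℙ

open Flag

_∈Coset[_]_ : Point → Bool → Flag → Bool
p ∈Coset[ ε ] c = inCoset ε (dir c) (syndrome c) p

cosetSet : Bool → Flag → IndependentSet
cosetSet ε c@(flag v v≢𝟎 s s⊥v) = record
  { member      = _∈Coset[ ε ] c
  ; cong-member = λ {p} {q} p≈q → cong (λ x → ⌊ syn ε v x ≟ s ⌋) (≈₁⇒code≡ {p} {q} p≈q)
  ; size        = enumerated (coset-unique ε v s) (length-coset ε v v≢𝟎 s s⊥v)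
      λ p → mk⇔ (from (∈-coset ε v s) ∘ toWitness) (fromWitness ∘ to (∈-coset ε v s))
  ; independent = λ {p} {q} p∈ q∈ adj → contradiction
      (trans (sym (Adjacent⇒ p q adj))
        (kernel-singular ε v v≢𝟎 _ (syn-difference ε v _ _ (trans (toWitness p∈) (sym (toWitness q∈))))))
      λ ()
  }

coset-injective : ∀ {ε ε′} c d → (∀ p → p ∈Coset[ ε ] c ≡ p ∈Coset[ ε′ ] d) → ε ≡ ε′ × dir c ≡ dir d × syndrome c ≡ syndrome d
coset-injective {ε} {ε′} (flag v v≢𝟎 s s⊥v) (flag u u≢𝟎 r r⊥u) c≗d = ε≡ε′ , v≡u , s≡r
  where
  transfer : ∀ x → syn ε v x ≡ s → syn ε′ u x ≡ r
  transfer x x∈ = trans (cong (syn ε′ u) (sym (code-point x))) (toWitness (subst T (c≗d (point x))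
    (fromWitness (trans (cong (syn ε v) (code-point x)) x∈))))

  x₀∈ : ∃[ x ] syn ε v x ≡ s
  x₀∈ = syn-onto ε v v≢𝟎 s s⊥v

  x₀ : F 6
  x₀ = proj₁ x₀∈

  -- Each coset is a kernel shifted by the common element `x₀`, so inclusion of cosets gives
  -- inclusion of kernels.
  kernels : ε ≡ ε′ × v ≡ u
  kernels = kernel⊆kernel ε ε′ v v≢𝟎 u u≢𝟎 λ x x∈ →
    subst (λ z → syn ε′ u z ≡ 𝟎) (⊕-cancelʳ x x₀) (syn-difference ε′ u (x ⊕ x₀) x₀ (trans
      (transfer (x ⊕ x₀) (trans (syn-difference⁻ ε v (x ⊕ x₀) x₀ (subst (λ z → syn ε v z ≡ 𝟎) (sym (⊕-cancelʳ x x₀)) x∈)) (proj₂ x₀∈)))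
      (sym (transfer x₀ (proj₂ x₀∈)))))

  ε≡ε′ = proj₁ kernels
  v≡u  = proj₂ kernels

  s≡r : s ≡ r
  s≡r = begin
    s           ≡⟨ proj₂ x₀∈ ⟨
    syn ε v x₀  ≡⟨ cong₂ (λ η w → syn η w x₀) ε≡ε′ v≡u ⟩
    syn ε′ u x₀ ≡⟨ transfer x₀ (proj₂ x₀∈) ⟩
    r           ∎

¬≡1ℙ⇒≡0ℙ : ∀ {a} → a ≢ 1ℙ → a ≡ 0ℙ
¬≡1ℙ⇒≡0ℙ {0ℙ} _     = refl
¬≡1ℙ⇒≡0ℙ {1ℙ} 1≢1 = contradiction refl 1≢1

-- Independent sets of size 8 are cosets.

module _ (A : IndependentSet) where
  private
    f : Fin 8 → Point
    f = proj₁ (size A)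

    f-injective : ∀ {i j} → f i ≈₁ f j → i ≡ j
    f-injective = proj₁ (proj₂ (size A))

    ∈A⇔ : ∀ p → p ∈ elements A ⇔ (∃[ i ] p ≈₁ f i)
    ∈A⇔ = proj₂ (proj₂ (size A))

    x : Fin 8 → F 6
    x i = code (f i)

    x-injective : Injective _≡_ _≡_ x
    x-injective {i} {j} e = f-injective (code≡⇒≈₁ {f i} {f j} e)

    f∈A : ∀ i → f i ∈ elements A
    f∈A i = from (∈A⇔ (f i)) (i , inj₁ λ _ → refl)

    singular : ∀ i j → Singular (x i ⊕ x j)
    singular i j = ¬≡1ℙ⇒≡0ℙ λ eq → independent A (f∈A i) (f∈A j) (⇒Adjacent (f i) (f j) eq)

    -- Shifting one member to the origin makes the elements themselves singular, not only their
    -- differences.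
    d : Fin 8 → F 6
    d i = x i ⊕ x 0F

    d-singular : ∀ i j → Singular (d i ⊕ d j)
    d-singular i j = subst Singular (sym (⊕-difference (x i) (x j) (x 0F))) (singular i j)

    d≢𝟎 : ∀ i → i ≢ 0F → d i ≢ 𝟎
    d≢𝟎 i i≢0 e = i≢0 (x-injective (⊕≡𝟎⇒≡ (x i) (x 0F) e))

    d₁≢d₂ : d 1F ≢ d 2F
    d₁≢d₂ e = case x-injective {1F} {2F} (begin
      x 1F            ≡⟨ ⊕-cancelʳ (x 1F) (x 0F) ⟨
      d 1F ⊕ x 0F     ≡⟨ cong (_⊕ x 0F) e ⟩
      d 2F ⊕ x 0F     ≡⟨ ⊕-cancelʳ (x 2F) (x 0F) ⟩
      x 2F            ∎) of λ ()

    -- `d 1F` and `d 2F` span a totally singular plane, which lies in one maximal subspace of each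
    -- family. Every other `d i` lies in one of these two.
    inKernel : ∃[ ε ] ∃[ v ] v ≢ 𝟎 × (∀ i → syn ε v (d i) ≡ 𝟎)
    inKernel =
      let v , v≢𝟎 , _ , _ , u , u≢𝟎 , _ , _ , v⊥u , dichotomy =
            singular-pair (d 1F) (singular 1F 0F) (d≢𝟎 1F λ ()) (d 2F) (singular 2F 0F)
              (d-singular 1F 2F) (d≢𝟎 2F λ ()) d₁≢d₂
      in choose v v≢𝟎 u u≢𝟎 v⊥u λ i → dichotomy (d i) (singular i 0F) (d-singular i 1F) (d-singular i 2F)
      where
      choose : ∀ v → v ≢ 𝟎 → ∀ u → u ≢ 𝟎 → v · u ≡ 0ℙ → (∀ i → syn false v (d i) ≡ 𝟎 ⊎ syn true u (d i) ≡ 𝟎) →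
               ∃[ ε ] ∃[ w ] w ≢ 𝟎 × (∀ i → syn ε w (d i) ≡ 𝟎)
      choose v v≢𝟎 u u≢𝟎 v⊥u split with allFin? (λ i → syn false v (d i) ≟ 𝟎)
      ... | yes ∀i = false , v , v≢𝟎 , ∀i
      -- An element `d j` outside the first kernel lies in the second. By `opposite-kernels` it then
      -- forces every `d i` of the first kernel into the second as well.
      ... | no ¬∀i with j , dⱼ∉ ← ¬∀⟶∃¬ 8 _ (λ i → syn false v (d i) ≟ 𝟎) ¬∀i = true , u , u≢𝟎 , λ i →
            [ (λ dᵢ∈ → [ id , (λ dⱼ∈ → contradiction dⱼ∈ dⱼ∉) ]′
                (opposite-kernels v u v⊥u (d i) dᵢ∈ (d j) ([ (λ dⱼ∈ → contradiction dⱼ∈ dⱼ∉) , id ]′ (split j)) (d-singular i j)))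
            , id ]′ (split i)

    kernel⇒coset : ∀ ε v → v ≢ 𝟎 → (∀ i → syn ε v (d i) ≡ 𝟎) → ∃[ c ] ∀ p → member A p ≡ p ∈Coset[ ε ] c
    kernel⇒coset ε v v≢𝟎 d∈ = flag v v≢𝟎 s (syn-⊥ ε v (x 0F)) , λ p → T-ext
      (λ p∈A → let i , p≈fᵢ = to (∈A⇔ p) p∈A in fromWitness (trans (cong (syn ε v) (≈₁⇒code≡ {p} {f i} p≈fᵢ)) (x∈ i)))
      (λ p∈ → let i , eq = injective⇒exhaustive (length-coset ε v v≢𝟎 s (syn-⊥ ε v (x 0F))) x-injective
                             (λ i → from (∈-coset ε v s) (x∈ i)) (from (∈-coset ε v s) (toWitness p∈))
              in from (∈A⇔ p) (i , code≡⇒≈₁ {p} {f i} eq))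
      where
      s : F 4
      s = syn ε v (x 0F)

      x∈ : ∀ i → syn ε v (x i) ≡ s
      x∈ i = syn-difference⁻ ε v (x i) (x 0F) (d∈ i)

  isCoset : ∃[ ε ] ∃[ c ] ∀ p → member A p ≡ p ∈Coset[ ε ] c
  isCoset = let ε , v , v≢𝟎 , d∈ = inKernel in ε , kernel⇒coset ε v v≢𝟎 d∈

-- The group action on cosets.

-- Defined for odd permutations too, since an even one is analysed one transposition at a time.
permute : Permutation′ 8 → Point → Point
permute π p = record
  { coords = λ k → coords p (π ⟨$⟩ˡ k)
  ; even   = trans (sym (sumℙ-permute (coords p) (Perm.flip π))) (even p)
  }

code-transpose : ∀ i j → i ≢ j → ∀ p → code (permute (Perm.transpose i j) p) ≡ reflect (root i j) (code p)
code-transpose i j i≢j p = begin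
  code (permute τ p)                                                      ≡⟨ cong enc (tabulate-cong λ k → sym (lookup∘tabulate (coords p) (τ ⟨$⟩ˡ k))) ⟩
  enc (tabulate λ k → Vec.lookup (tabulate (coords p)) (τ ⟨$⟩ˡ k))        ≡⟨ enc-transpose i j i≢j (tabulate (coords p)) (even p) ⟩
  reflect (root i j) (code p)                                             ∎
  where τ = Perm.transpose i j

-- The two alternating matrices of `r` carry `v` and `s` to the dual spaces, which changes the
-- family.
reflectFlag : ∀ ε r → quad r ≡ 1ℙ → Flag → Flag
reflectFlag ε r q (flag v v≢𝟎 s s⊥v) =
  flag (syn ε v r) (syn-≢𝟎 ε r q v v≢𝟎) (syn (not ε) s r) (trans (syn-· ε r q v s) s⊥v)

-- Applying the invertible map `syn (not ε) _ r` to the equation of the swapped point turns it, by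
-- `syn-reflect`, into an equation for `p` in the other family.
coset-transpose : ∀ ε c i j (i≢j : i ≢ j) p →
  permute (Perm.transpose i j) p ∈Coset[ ε ] c ≡ p ∈Coset[ not ε ] reflectFlag ε (root i j) (quad-root i j i≢j) c
coset-transpose ε (flag v _ s _) i j i≢j p = inCoset-cong ε v s (permute (Perm.transpose i j) p) (not ε) (syn ε v r) (syn (not ε) s r) p
  (λ e → begin
    syn (not ε) (syn ε v r) x             ≡⟨ syn-reflect ε r q v x ⟨
    syn (not ε) (syn ε v (reflect r x)) r ≡⟨ cong (λ y → syn (not ε) (syn ε v y) r) (code-transpose i j i≢j p) ⟨
    syn (not ε) (syn ε v y) r             ≡⟨ cong (λ t → syn (not ε) t r) e ⟩
    syn (not ε) s r                       ∎)
  (λ e → begin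
    syn ε v y                                           ≡⟨ cong (syn ε v) (code-transpose i j i≢j p) ⟩
    syn ε v (reflect r x)                               ≡⟨ inverse _ ⟨
    syn ε (syn (not ε) (syn ε v (reflect r x)) r) r     ≡⟨ cong (λ t → syn ε t r) (trans (syn-reflect ε r q v x) e) ⟩
    syn ε (syn (not ε) s r) r                           ≡⟨ inverse s ⟩
    s                                                   ∎)
  where
  r = root i j
  q = quad-root i j i≢j
  x = code p
  y = code (permute (Perm.transpose i j) p)

  inverse : ∀ t → syn ε (syn (not ε) t r) r ≡ t
  inverse t = subst (λ η → syn η (syn (not ε) t r) r ≡ t) (not-involutive ε) (syn-involutive (not ε) r q t)

iterate-not : ℕ → Bool → Bool
iterate-not zero    ε = ε
iterate-not (suc n) ε = not (iterate-not n ε)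

iterate-not-even : ∀ {n} → 2 ∣ n → ∀ ε → iterate-not n ε ≡ ε
iterate-not-even (divides q refl) = go q
  where
  go : ∀ q ε → iterate-not (q *ᴺ 2) ε ≡ ε
  go zero    ε = refl
  go (suc q) ε = trans (not-involutive _) (go q ε)

coset-eval : ∀ ts → All (λ (i , j) → i ≢ j) ts → ∀ ε c →
  ∃[ d ] ∀ p → permute (eval ts) p ∈Coset[ ε ] c ≡ p ∈Coset[ iterate-not (length ts) ε ] d
coset-eval []             []               ε c = c , λ p → refl
coset-eval ((i , j) ∷ ts) (i≢j ∷ distinct) ε c =
  let d , eq = coset-eval ts distinct ε c
  in reflectFlag _ (root i j) (quad-root i j i≢j) d ,
     -- `eval` lets the head transposition act on the point first, so `eq` applies to the point
     -- already swapped.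
     λ p → trans (eq (permute (Perm.transpose i j) p)) (coset-transpose _ d i j i≢j p)

⟨$⟩ˡ-cong : ∀ {n} {π ρ : Permutation′ n} → π Perm.≈ ρ → ∀ k → π ⟨$⟩ˡ k ≡ ρ ⟨$⟩ˡ k
⟨$⟩ˡ-cong {π = π} {ρ} π≈ρ k = begin
  π ⟨$⟩ˡ k                           ≡⟨ Perm.inverseˡ ρ ⟨
  ρ ⟨$⟩ˡ (ρ ⟨$⟩ʳ (π ⟨$⟩ˡ k))         ≡⟨ cong (ρ ⟨$⟩ˡ_) (π≈ρ (π ⟨$⟩ˡ k)) ⟨
  ρ ⟨$⟩ˡ (π ⟨$⟩ʳ (π ⟨$⟩ˡ k))         ≡⟨ cong (ρ ⟨$⟩ˡ_) (Perm.inverseʳ π) ⟩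
  ρ ⟨$⟩ˡ k                           ∎

translateFlag : Bool → F 6 → Flag → Flag
translateFlag ε t (flag v v≢𝟎 s s⊥v) = flag v v≢𝟎 (s ⊕ syn ε v t) (begin
  (s ⊕ syn ε v t) · v         ≡⟨ ·-distribʳ-⊕ v s (syn ε v t) ⟩
  (s · v) + (syn ε v t · v)   ≡⟨ cong₂ _+_ s⊥v (syn-⊥ ε v t) ⟩
  0ℙ                          ∎)

coset-translate : ∀ ε c t p → act (translation t) p ∈Coset[ ε ] c ≡ p ∈Coset[ ε ] translateFlag ε (code t) c
coset-translate ε (flag v _ s _) t p = inCoset-cong ε v s (act (translation t) p) ε v (s ⊕ syn ε v (code t)) p
  (λ e → x⊕y≡z⇒x≡z⊕y _ _ (trans (sym split) e))
  (λ e → trans split (x≡z⊕y⇒x⊕y≡z _ _ e))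
  where
  split : syn ε v (code (act (translation t) p)) ≡ syn ε v (code p) ⊕ syn ε v (code t)
  split = begin
    syn ε v (code (act (translation t) p))    ≡⟨ cong (syn ε v) (code-translation t p) ⟩
    syn ε v (code t ⊕ code p)                 ≡⟨ cong (syn ε v) (⊕-comm (code t) (code p)) ⟩
    syn ε v (code p ⊕ code t)                 ≡⟨ syn-⊕ ε v (code p) (code t) ⟩
    syn ε v (code p) ⊕ syn ε v (code t)       ∎

coset-act : ∀ g ε c → ∃[ d ] ∀ p → act g p ∈Coset[ ε ] c ≡ p ∈Coset[ ε ] d
coset-act (translation t) ε c = translateFlag ε (code t) c , coset-translate ε c t
coset-act (permutation π) ε c = proj₁ image , λ p → begin
  act (permutation π) p ∈Coset[ ε ] c
    ≡⟨ cong-member (cosetSet ε c) {act (permutation π) p} {permute (eval ts) p}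
         (inj₁ λ k → cong (coords p) (sym (⟨$⟩ˡ-cong {π = eval ts} {perm π} (factorisation π) k))) ⟩
  permute (eval ts) p ∈Coset[ ε ] c
    ≡⟨ proj₂ image p ⟩
  p ∈Coset[ iterate-not (length ts) ε ] proj₁ image
    ≡⟨ cong (λ η → p ∈Coset[ η ] proj₁ image) (iterate-not-even (evenLength π) ε) ⟩
  p ∈Coset[ ε ] proj₁ image
    ∎
  where
  ts    = transpositions π
  image = coset-eval ts (proper π) ε c

coset-actWord : ∀ g ε c → ∃[ d ] ∀ p → actWord g p ∈Coset[ ε ] c ≡ p ∈Coset[ ε ] d
coset-actWord []      ε c = c , λ p → refl
coset-actWord (h ∷ g) ε c =
  let d , eq  = coset-act h ε c
      e , eq′ = coset-actWord g ε d
  in e , λ p → trans (eq (actWord g p)) (eq′ p)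

twoTranspositions : ∀ i j → i ≢ j → ∀ k l → k ≢ l → EvenPermutation
twoTranspositions i j i≢j k l k≢l = record
  { perm           = eval ((i , j) ∷ (k , l) ∷ [])
  ; transpositions = (i , j) ∷ (k , l) ∷ []
  ; proper         = i≢j ∷ k≢l ∷ []
  ; evenLength     = divides 1 refl
  ; factorisation  = λ _ → refl
  }

-- Two transpositions adjust the direction, and a translation then adjusts the syndrome.
coset-transitive : ∀ ε c d → ∃[ g ] ∀ p → p ∈Coset[ ε ] c ≡ actWord g p ∈Coset[ ε ] d
coset-transitive ε c d =
  let r , q , r′ , q′ , v≡     = syn-transitive ε (dir d) (dir≢𝟎 d) (dir c) (dir≢𝟎 c)
      i , j , i≢j , r≡         = quad-root⁻ r q
      i′ , j′ , i′≢j′ , r′≡    = quad-root⁻ r′ q′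
      -- Membership in `d` is pulled back through `i , j` first, so this swap acts last on points
      -- and is listed second.
      π                        = twoTranspositions i′ j′ i′≢j′ i j i≢j
      d₁                       = reflectFlag ε (root i j) (quad-root i j i≢j) d
      d₂                       = reflectFlag (not ε) (root i′ j′) (quad-root i′ j′ i′≢j′) d₁
      dir-d₂                   = trans (cong₂ (λ x y → syn (not ε) (syn ε (dir d) x) y) r≡ r′≡) v≡
      s                        = syn (not (not ε)) (syndrome d₁) (root i′ j′)
      -- The translation has to make up the difference between `s`, reached by the swaps, and the
      -- syndrome of `c`.
      t , t≡                   = syn-onto ε (dir c) (dir≢𝟎 c) (syndrome c ⊕ s) (sum-incident dir-d₂ (incident d₂))
  in permutation π ∷ translation (point t) ∷ [] , λ p → sym (begin
       act (permutation π) (act (translation (point t)) p) ∈Coset[ ε ] d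
         ≡⟨ coset-transpose ε d i j i≢j (permute (Perm.transpose i′ j′) (act (translation (point t)) p)) ⟩
       permute (Perm.transpose i′ j′) (act (translation (point t)) p) ∈Coset[ not ε ] d₁
         ≡⟨ coset-transpose (not ε) d₁ i′ j′ i′≢j′ (act (translation (point t)) p) ⟩
       act (translation (point t)) p ∈Coset[ not (not ε) ] d₂
         ≡⟨ coset-translate (not (not ε)) d₂ (point t) p ⟩
       p ∈Coset[ not (not ε) ] translateFlag (not (not ε)) (code (point t)) d₂
         ≡⟨ cong (λ η → inCoset η (dir d₂) (s ⊕ syn η (dir d₂) (code (point t))) p) (not-involutive ε) ⟩
       inCoset ε (dir d₂) (s ⊕ syn ε (dir d₂) (code (point t))) p
         ≡⟨ cong₂ (λ v x → inCoset ε v (s ⊕ syn ε v x) p) dir-d₂ (code-point t) ⟩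
       inCoset ε (dir c) (s ⊕ syn ε (dir c) t) p
         ≡⟨ cong (λ r → inCoset ε (dir c) r p) (trans (cong (s ⊕_) (trans t≡ (⊕-comm (syndrome c) s))) (⊕-cancelˡ s (syndrome c))) ⟩
       p ∈Coset[ ε ] c
         ∎)
  where
  sum-incident : ∀ {v s} → v ≡ dir c → s · v ≡ 0ℙ → (syndrome c ⊕ s) · dir c ≡ 0ℙ
  sum-incident {s = s} refl s⊥ = trans (·-distribʳ-⊕ (dir c) (syndrome c) s) (cong₂ _+_ (incident c) s⊥)

-- The graph on flags and its isomorphism with Γ₁.

Flags : Graph
Flags = record
  { vertices = record
    { Carrier       = Flag
    ; _≈_           = λ c d → dir c ≡ dir d × syndrome c ≡ syndrome d
    ; isEquivalence = record
      { refl  = refl , refl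
      ; sym   = λ (p , q) → sym p , sym q
      ; trans = λ (p , q) (p′ , q′) → trans p p′ , trans q q′
      }
    }
  ; _∼_      = λ c d → dir c ≢ dir d × syndrome c · dir d ≡ syndrome d · dir c
  ; ∼-sym    = λ (v≢u , e) → v≢u ∘ sym , sym e
  ; irrefl   = λ (v≡u , _) (v≢u , _) → v≢u v≡u
  ; resp     = (λ { {flag _ _ _ _} {flag _ _ _ _} {flag _ _ _ _} (refl , refl) → id })
             , (λ { {flag _ _ _ _} {flag _ _ _ _} {flag _ _ _ _} (refl , refl) → id })
  }

-- An element `x₀` of the first coset is moved by a kernel element `z` that changes its second
-- syndrome by `r′`. The condition `s · u ≡ r · v` says that `r′` vanishes on `v`, which makes `z`
-- available. The intersection is then a coset of `𝟎` and `h`.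
meetInTwo : ∀ ε c d → Graph._∼_ Flags c d → MeetInTwo (cosetSet ε c) (cosetSet ε d)
meetInTwo ε (flag v v≢𝟎 s s⊥v) (flag u u≢𝟎 r r⊥u) (v≢u , s·u≡r·v) =
  let x₀ , syn-x₀ = syn-onto ε v v≢𝟎 s s⊥v
      r′          = r ⊕ syn ε u x₀
      r′⊥u        = trans (·-distribʳ-⊕ u r (syn ε u x₀)) (cong₂ _+_ r⊥u (syn-⊥ ε u x₀))
      r′⊥v        = begin
        (r ⊕ syn ε u x₀) · v       ≡⟨ ·-distribʳ-⊕ v r (syn ε u x₀) ⟩
        (r · v) + (syn ε u x₀ · v) ≡⟨ cong₂ _+_ (sym s·u≡r·v) (trans (syn-symmetric ε u v x₀) (cong (_· u) syn-x₀)) ⟩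
        (s · u) + (s · u)          ≡⟨ ℙ.p+p≡0ℙ (s · u) ⟩
        0ℙ                         ∎
      z , z∈v , z∈u              = syn-onto-kernel ε v v≢𝟎 u u≢𝟎 v≢u r′ r′⊥u r′⊥v
      h , h≢𝟎 , h∈v , h∈u , only = kernel∩kernel ε v v≢𝟎 u u≢𝟎 v≢u
      x          = z ⊕ x₀
      syn-x-v    = trans (syn-shift v z x₀ z∈v) syn-x₀
      syn-x-u    = trans (syn-⊕ ε u z x₀) (trans (cong (_⊕ syn ε u x₀) z∈u) (⊕-cancelʳ r (syn ε u x₀)))
      h⊕x≢x      = λ e → h≢𝟎 (trans (sym (⊕-cancelʳ h x)) (trans (cong (_⊕ x) e) (⊕-self x)))
  in enumerated {L = x ∷ (h ⊕ x) ∷ []} ((h⊕x≢x ∘ sym ∷ []) ∷ [] ∷ []) refl λ p → mk⇔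
       (λ (p∈c , p∈d) →
          [ (λ e → here (⊕≡𝟎⇒≡ (code p) x e)) , (λ e → there (here (x⊕y≡z⇒x≡z⊕y (code p) x e))) ]′
          (only (code p ⊕ x) (syn-difference ε v (code p) x (trans (toWitness p∈c) (sym syn-x-v)))
                             (syn-difference ε u (code p) x (trans (toWitness p∈d) (sym syn-x-u)))))
       λ { (here e)         → fromWitness (trans (cong (syn ε v) e) syn-x-v)
                            , fromWitness (trans (cong (syn ε u) e) syn-x-u)
         ; (there (here e)) → fromWitness (trans (cong (syn ε v) e) (trans (syn-shift v h x h∈v) syn-x-v))
                            , fromWitness (trans (cong (syn ε u) e) (trans (syn-shift u h x h∈u) syn-x-u)) }
  where
  syn-shift : ∀ w y x → syn ε w y ≡ 𝟎 → syn ε w (y ⊕ x) ≡ syn ε w x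
  syn-shift w y x y∈ = trans (syn-⊕ ε w y x) (trans (cong (_⊕ syn ε w x) y∈) (zipWith-identityˡ ℙ.+-identityˡ _))

module _ (A₀ : IndependentSet) where
  private
    family : Bool
    family = proj₁ (isCoset A₀)

    base : Flag
    base = proj₁ (proj₂ (isCoset A₀))

    A₀≗base : ∀ p → member A₀ p ≡ p ∈Coset[ family ] base
    A₀≗base = proj₂ (proj₂ (isCoset A₀))

    toElement : Flag → OrbitElement A₀
    toElement c = record
      { set     = cosetSet family c
      ; inOrbit = let g , eq = coset-transitive family base c in g , λ p → trans (A₀≗base p) (eq p)
      }

    -- Pulling a coset back along a word keeps its family, and the pullback of `B` is `A₀`.
    sameFamily : ∀ (B : OrbitElement A₀) {ε} c → (∀ p → member (set B) p ≡ p ∈Coset[ ε ] c) → family ≡ ε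
    sameFamily B {ε} c B≗c =
      let g , A₀≗B = inOrbit B
          d , eq   = coset-actWord g ε c
      in proj₁ (coset-injective base d λ p →
           trans (sym (A₀≗base p)) (trans (A₀≗B p) (trans (B≗c (actWord g p)) (eq p))))

    asFlag : (B : OrbitElement A₀) → ∃[ c ] ∀ p → member (set B) p ≡ p ∈Coset[ family ] c
    asFlag B = let ε , c , B≗c = isCoset (set B) in
      c , λ p → trans (B≗c p) (cong (λ η → p ∈Coset[ η ] c) (sym (sameFamily B c B≗c)))

    meets⇒adjacent : ∀ c d → MeetInTwo (cosetSet family c) (cosetSet family d) → Graph._∼_ Flags c d
    meets⇒adjacent c d meet@(f , _ , enum) = v≢u , (begin
      syndrome c · dir d               ≡⟨ cong (_· dir d) x∈c ⟨
      syn family (dir c) x · dir d     ≡⟨ syn-symmetric family (dir c) (dir d) x ⟩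
      syn family (dir d) x · dir c     ≡⟨ cong (_· dir c) x∈d ⟩
      syndrome d · dir c               ∎)
      where
      common : f 0F ∈ elements (cosetSet family c) ∩ elements (cosetSet family d)
      common = from (enum (f 0F)) (0F , inj₁ λ _ → refl)

      x : F 6
      x = code (f 0F)

      x∈c : syn family (dir c) x ≡ syndrome c
      x∈c = toWitness (proj₁ common)

      x∈d : syn family (dir d) x ≡ syndrome d
      x∈d = toWitness (proj₂ common)

      -- Cosets of equal direction that share a point coincide, and a set of size 8 does not meet
      -- itself in two points.
      v≢u : dir c ≢ dir d
      v≢u v≡u = Graph.irrefl (Γ₁ A₀) {toElement c} {toElement d}
        (λ p → cong₂ (λ v s → inCoset family v s p) v≡u (trans (sym x∈c) (trans (cong (λ v → syn family v x) v≡u) x∈d)))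
        meet

  -- Any independent set of size 8 may serve as `A₀`: its orbit is its whole family, and both
  -- families are parametrised by the same flags.
  Flags≅Γ₁ : Flags ≅ Γ₁ A₀
  Flags≅Γ₁ = record
    { bijection = record
      { to        = toElement
      ; from      = proj₁ ∘ asFlag
      ; to-cong   = λ (v≡u , s≡r) p → cong₂ (λ v s → inCoset family v s p) v≡u s≡r
      ; from-cong = λ {A} {B} A≗B → proj₂ (coset-injective (proj₁ (asFlag A)) (proj₁ (asFlag B)) λ p →
                      trans (sym (proj₂ (asFlag A) p)) (trans (A≗B p) (proj₂ (asFlag B) p)))
      ; inverse   = (λ {B} {c} (v≡u , s≡r) p → trans (cong₂ (λ v s → inCoset family v s p) v≡u s≡r) (sym (proj₂ (asFlag B) p)))
                  , (λ {c} {B} B≗c → proj₂ (coset-injective (proj₁ (asFlag B)) c λ p → trans (sym (proj₂ (asFlag B) p)) (B≗c p)))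
      }
    ; adjacency = λ c d → mk⇔ (meetInTwo family c d) (meets⇒adjacent c d)
    }

-- Lines of E₈ as flags.

-- The most significant bit comes first, as in the lexicographic order of `_⊗_`, so each tensor
-- factor acts on its own bit.
bits : Fin 8 → F 3
bits 0F = 0ℙ ∷ 0ℙ ∷ 0ℙ ∷ []
bits 1F = 0ℙ ∷ 0ℙ ∷ 1ℙ ∷ []
bits 2F = 0ℙ ∷ 1ℙ ∷ 0ℙ ∷ []
bits 3F = 0ℙ ∷ 1ℙ ∷ 1ℙ ∷ []
bits 4F = 1ℙ ∷ 0ℙ ∷ 0ℙ ∷ []
bits 5F = 1ℙ ∷ 0ℙ ∷ 1ℙ ∷ []
bits 6F = 1ℙ ∷ 1ℙ ∷ 0ℙ ∷ []
bits 7F = 1ℙ ∷ 1ℙ ∷ 1ℙ ∷ []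

-- The cross product in characteristic two. For `δ` nonzero, `cross x δ` determines `x` up to adding
-- `δ`, so its value names a pair of indices.
cross : F 3 → F 3 → F 3
cross (a ∷ b ∷ c ∷ []) (d ∷ e ∷ f ∷ []) = (b * f) + (c * e) ∷ (a * f) + (c * d) ∷ (a * e) + (b * d) ∷ []

quadratic : F 3 → F 3 → Parity
quadratic (k ∷ l ∷ m ∷ []) (a ∷ b ∷ c ∷ []) = (k * (b * c)) + (l * (a * c)) + (m * (a * b))

-- Reads the coordinate at the first one of `δ`. It differs between the two indices of a pair, which
-- makes `β` their relative sign.
pivot : F 3 → F 3 → Parity
pivot (1ℙ ∷ _)      (a ∷ _)         = a
pivot (0ℙ ∷ 1ℙ ∷ _) (_ ∷ b ∷ _)     = b
pivot (0ℙ ∷ 0ℙ ∷ _) (_ ∷ _ ∷ c ∷ _) = c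

sgn : Parity → ℤ
sgn 0ℙ = 1ℤ
sgn 1ℙ = -1ℤ

opaque
  -- With coordinates indexed by 𝔽₂³, X^a Z^b sends eᵢ to ± eᵢ₊ₐ and a sign vector
  -- (-1)^f(i) to ± (-1)^(f(i+a) + b·i). The orbits are therefore the lines
  -- eᵢ ± eᵢ₊δ for a fixed δ, and the sign vectors (-1)^f with f of fixed
  -- quadratic part κ.
  rep : F 4 → F 4 → Vector ℤ 8
  rep (1ℙ ∷ κ) (_ ∷ s) i = sgn (quadratic κ (bits i) + (s · bits i))
  rep (0ℙ ∷ δ) (β ∷ s) i = if ⌊ cross (bits i) δ ≟ s ⌋ then sgn (β * pivot δ (bits i)) else 0ℤ

infix 4 _≈±?_

_≈±?_ : ∀ {n} (x y : Vector ℤ n) → Dec (x ≈± y)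
x ≈±? y = allFin? (λ k → x k ℤ.≟ y k) ⊎-dec allFin? (λ k → x k ℤ.≟ - y k)

short : Fin 8 → Fin 8 → Sign → Sign → Vector ℤ 8
short i j s t k = ±1 s *ᶻ basis i k +ᶻ ±1 t *ᶻ basis j k

isRoot? : Decidable IsRoot
isRoot? x = map′
  [ (λ (p , q) → signs p q) , (λ (i , j , i<j , s , t , p) → ±eᵢ±eⱼ i j i<j s t p) ]′
  (λ { (signs p q) → inj₁ (p , q) ; (±eᵢ±eⱼ i j i<j s t p) → inj₂ (i , j , i<j , s , t , p) })
  ((allFin? (λ k → x k ℤ.≟ 1ℤ ⊎-dec x k ℤ.≟ -1ℤ) ×-dec product x ℤ.≟ 1ℤ)
    ⊎-dec anyFin? λ i → anyFin? λ j → i <? j ×-dec anySign? λ s → anySign? λ t → allFin? λ k → x k ℤ.≟ short i j s t k)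

pauli : Parity → Parity → Pauli
pauli 0ℙ 0ℙ = I
pauli 1ℙ 0ℙ = X
pauli 1ℙ 1ℙ = Y
pauli 0ℙ 1ℙ = Z

paulis : F 6 → Matrix 8 8
paulis (a ∷ b ∷ c ∷ d ∷ e ∷ f ∷ []) = tensor (pauli a d) (pauli b e) (pauli c f)

isZero : ℤ → Parity
isZero z = if ⌊ z ℤ.≟ 0ℤ ⌋ then 1ℙ else 0ℙ

opaque
  unfolding rep syn

  rep-isRoot : ∀ v → v ≢ 𝟎 → ∀ s → s · v ≡ 0ℙ → IsRoot (rep v s)
  rep-isRoot = toWitness {a? = all? λ v → ¬? (v ≟ 𝟎) →-dec all? λ s → (s · v ℙ.≟ 0ℙ) →-dec isRoot? (rep v s)} _

  short-rep : ∀ i j → i <ᶠ j → ∀ s t → ∃[ v ] v ≢ 𝟎 × ∃[ r ] r · v ≡ 0ℙ × short i j s t ≈± rep v r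
  short-rep = toWitness {a? = allFin? λ i → allFin? λ j → i <? j →-dec allSign? λ s → allSign? λ t →
    any? λ v → ¬? (v ≟ 𝟎) ×-dec any? λ r → r · v ℙ.≟ 0ℙ ×-dec short i j s t ≈±? rep v r} _

  -- Product one means an exponent of even weight, that is, a polynomial of degree at most two on
  -- 𝔽₂³. Its constant term is the overall sign.
  signs-rep : ∀ y → product (sgn ∘ Vec.lookup y) ≡ 1ℤ →
    ∃[ v ] v ≢ 𝟎 × ∃[ r ] r · v ≡ 0ℙ × (sgn ∘ Vec.lookup y) ≈± rep v r
  signs-rep = toWitness {a? = all? λ y → (product (sgn ∘ Vec.lookup y) ℤ.≟ 1ℤ) →-dec
    any? λ v → ¬? (v ≟ 𝟎) ×-dec any? λ r → r · v ℙ.≟ 0ℙ ×-dec (sgn ∘ Vec.lookup y) ≈±? rep v r} _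

  -- The syndrome coordinate that `rep` drops for directions starting with one is recovered from
  -- incidence.
  rep-injective : ∀ v → v ≢ 𝟎 → ∀ s → s · v ≡ 0ℙ → ∀ u → u ≢ 𝟎 → ∀ r → r · u ≡ 0ℙ →
    rep v s ≈± rep u r → v ≡ u × s ≡ r
  rep-injective = toWitness {a? = all? λ v → ¬? (v ≟ 𝟎) →-dec all? λ s → (s · v ℙ.≟ 0ℙ) →-dec
    all? λ u → ¬? (u ≟ 𝟎) →-dec all? λ r → (r · u ℙ.≟ 0ℙ) →-dec
    (rep v s ≈±? rep u r) →-dec (v ≟ u ×-dec s ≟ r)} _

  rep-orbit : ∀ v → v ≢ 𝟎 → ∀ s → s · v ≡ 0ℙ → ∃[ m ] syn false v m ≡ s × rep v s ≈± paulis m ·ᵥ rep v 𝟎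
  rep-orbit = toWitness {a? = all? λ v → ¬? (v ≟ 𝟎) →-dec all? λ s → (s · v ℙ.≟ 0ℙ) →-dec
    any? λ m → syn false v m ≟ s ×-dec rep v s ≈±? paulis m ·ᵥ rep v 𝟎} _

  -- The Pauli group preserves orthogonality and the bit `(s · u) + (r · v)`. On the 64 pairs of
  -- lines with directions `v` and `u` the stabilisers have order 2, so there are two orbits, told
  -- apart by this bit; one consists of the orthogonal pairs.
  rep-orthogonal : ∀ v → v ≢ 𝟎 → ∀ u → u ≢ 𝟎 → v ≢ u → ∀ s → s · v ≡ 0ℙ → ∀ r → r · u ≡ 0ℙ →
    isZero ⟨ rep v s , rep u r ⟩ ≡ isZero ⟨ rep v 𝟎 , rep u 𝟎 ⟩ + (s · u) + (r · v)
  rep-orthogonal = toWitness {a? = all? λ v → ¬? (v ≟ 𝟎) →-dec all? λ u → ¬? (u ≟ 𝟎) →-dec ¬? (v ≟ u) →-dec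
    all? λ s → (s · v ℙ.≟ 0ℙ) →-dec all? λ r → (r · u ℙ.≟ 0ℙ) →-dec
    (isZero ⟨ rep v s , rep u r ⟩ ℙ.≟ isZero ⟨ rep v 𝟎 , rep u 𝟎 ⟩ + (s · u) + (r · v))} _

  -- The Pauli matrices in the kernel of `v` are symmetric and commute, and the eight lines are
  -- their joint eigenlines.
  rep-frame : ∀ v → v ≢ 𝟎 → ∀ s → s · v ≡ 0ℙ → ∀ r → r · v ≡ 0ℙ → s ≢ r → ⟨ rep v s , rep v r ⟩ ≡ 0ℤ
  rep-frame = toWitness {a? = all? λ v → ¬? (v ≟ 𝟎) →-dec all? λ s → (s · v ℙ.≟ 0ℙ) →-dec
    all? λ r → (r · v ℙ.≟ 0ℙ) →-dec ¬? (s ≟ r) →-dec (⟨ rep v s , rep v r ⟩ ℤ.≟ 0ℤ)} _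

product-cong : ∀ {n} {x y : Vector ℤ n} → (∀ k → x k ≡ y k) → product x ≡ product y
product-cong {zero}  e = refl
product-cong {suc n} e = cong₂ _*ᶻ_ (e zero) (product-cong (e ∘ suc))

line : Flag → Vector ℤ 8
line c = rep (dir c) (syndrome c)

sign-bit : ∀ {z} → z ≡ 1ℤ ⊎ z ≡ -1ℤ → ∃[ a ] z ≡ sgn a
sign-bit (inj₁ e) = 0ℙ , e
sign-bit (inj₂ e) = 1ℙ , e

root-line : ∀ {x} → IsRoot x → ∃[ c ] x ≈± line c
root-line (±eᵢ±eⱼ i j i<j s t x≗) =
  let v , v≢𝟎 , r , r⊥v , e = short-rep i j i<j s t in flag v v≢𝟎 r r⊥v , ≈±-trans (inj₁ x≗) e
root-line {x} (signs ±1s prod) =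
  let v , v≢𝟎 , r , r⊥v , e = signs-rep y (trans (sym (product-cong x≗)) prod) in flag v v≢𝟎 r r⊥v , ≈±-trans (inj₁ x≗) e
  where
  y : F 8
  y = tabulate (λ k → proj₁ (sign-bit (±1s k)))

  x≗ : ∀ k → x k ≡ sgn (Vec.lookup y k)
  x≗ k = trans (proj₂ (sign-bit (±1s k))) (cong sgn (sym (lookup∘tabulate (λ k → proj₁ (sign-bit (±1s k))) k)))

flagOf : Root → Flag
flagOf x = proj₁ (root-line (isRoot x))

≈±-line : ∀ x → vec x ≈± line (flagOf x)
≈±-line x = proj₂ (root-line (isRoot x))

rootOf : Flag → Root
rootOf c@(flag v v≢𝟎 s s⊥v) = record { vec = line c ; isRoot = rep-isRoot v v≢𝟎 s s⊥v }

line-injective : ∀ c d → line c ≈± line d → dir c ≡ dir d × syndrome c ≡ syndrome d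
line-injective (flag v v≢𝟎 s s⊥v) (flag u u≢𝟎 r r⊥u) = rep-injective v v≢𝟎 s s⊥v u u≢𝟎 r r⊥u

-- `flagOf` is computed from the particular proof of `isRoot`; injectivity of `line` makes the
-- result independent of it.
flagOf-unique : ∀ x c → vec x ≈± line c → dir (flagOf x) ≡ dir c × syndrome (flagOf x) ≡ syndrome c
flagOf-unique x c x≈c = line-injective (flagOf x) c (≈±-trans (≈±-sym (≈±-line x)) x≈c)

flagOf-cong : ∀ x y → vec x ≈± vec y → dir (flagOf x) ≡ dir (flagOf y) × syndrome (flagOf x) ≡ syndrome (flagOf y)
flagOf-cong x y x≈y = flagOf-unique x (flagOf y) (≈±-trans x≈y (≈±-line y))

flagOf-injective : ∀ x y → dir (flagOf x) ≡ dir (flagOf y) → syndrome (flagOf x) ≡ syndrome (flagOf y) → vec x ≈± vec y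
flagOf-injective x y v≡u s≡r = ≈±-trans (≈±-line x) (≈±-trans (inj₁ λ k → cong₂ (λ v s → rep v s k) v≡u s≡r) (≈±-sym (≈±-line y)))

origin : ∀ v → v ≢ 𝟎 → Flag
origin v v≢𝟎 = flag v v≢𝟎 𝟎 (𝟎-· v)
  where
  𝟎-· : ∀ {n} (x : F n) → 𝟎 · x ≡ 0ℙ
  𝟎-· []      = refl
  𝟎-· (_ ∷ x) = 𝟎-· x

base : ∀ v → v ≢ 𝟎 → Root
base v v≢𝟎 = rootOf (origin v v≢𝟎)

base-orbit : ∀ x → SameOrbit (base (dir (flagOf x)) (dir≢𝟎 (flagOf x))) x
base-orbit x =
  let c           = flagOf x
      m , _ , c≈M = rep-orbit (dir c) (dir≢𝟎 c) (syndrome c) (incident c)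
  in components m (≈±-trans (≈±-line x) c≈M)
  where
  components : ∀ {v y} m → y ≈± paulis m ·ᵥ rep v 𝟎 → ∃[ M₁ ] ∃[ M₂ ] ∃[ M₃ ] y ≈± tensor M₁ M₂ M₃ ·ᵥ rep v 𝟎
  components (a ∷ b ∷ c ∷ d ∷ e ∷ f ∷ []) y≈M = pauli a d , pauli b e , pauli c f , y≈M

-- Orthogonality as a parity.

isZero-≡ : ∀ {z} → z ≡ 0ℤ → isZero z ≡ 1ℙ
isZero-≡ refl = refl

isZero-≢ : ∀ {z} → z ≢ 0ℤ → isZero z ≡ 0ℙ
isZero-≢ {z} z≢0 with z ℤ.≟ 0ℤ
... | yes z≡0 = contradiction z≡0 z≢0
... | no _    = refl

isZero-cong : ∀ {a b} → (a ≡ 0ℤ → b ≡ 0ℤ) → (b ≡ 0ℤ → a ≡ 0ℤ) → isZero a ≡ isZero b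
isZero-cong {a} {b} f g with b ℤ.≟ 0ℤ
... | yes b≡0 = isZero-≡ (g b≡0)
... | no b≢0  = isZero-≢ (b≢0 ∘ f)

-- With `b` the product of the two chosen roots, the left side is non-adjacency in the switched
-- graph.
isZero≡⇔ : ∀ a b → (¬ ((b ≢ 0ℤ × a ≡ 0ℤ) ⊎ (b ≡ 0ℤ × ¬ a ≡ 0ℤ))) ⇔ (isZero a ≡ isZero b)
isZero≡⇔ a b with a ℤ.≟ 0ℤ | b ℤ.≟ 0ℤ
... | yes a≡0 | yes b≡0 = mk⇔ (λ _ → refl) λ { _ (inj₁ (b≢0 , _)) → b≢0 b≡0 ; _ (inj₂ (_ , a≢0)) → a≢0 a≡0 }
... | yes a≡0 | no  b≢0 = mk⇔ (λ ¬s → contradiction (inj₁ (b≢0 , a≡0)) ¬s) λ ()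
... | no  a≢0 | yes b≡0 = mk⇔ (λ ¬s → contradiction (inj₂ (b≡0 , a≢0)) ¬s) λ ()
... | no  a≢0 | no  b≢0 = mk⇔ (λ _ → refl) λ { _ (inj₁ (_ , a≡0)) → a≢0 a≡0 ; _ (inj₂ (b≡0 , _)) → b≢0 b≡0 }

isZero-roots : ∀ x y → isZero ⟨ vec x , vec y ⟩ ≡ isZero ⟨ line (flagOf x) , line (flagOf y) ⟩
isZero-roots x y = isZero-cong (move (≈±-line x) (≈±-line y)) (move (≈±-sym (≈±-line x)) (≈±-sym (≈±-line y)))
  where
  move : ∀ {a b c d : Vector ℤ 8} → a ≈± c → b ≈± d → ⟨ a , b ⟩ ≡ 0ℤ → ⟨ c , d ⟩ ≡ 0ℤ
  move {b = b} {c} a≈c b≈d = ⊥-respʳ c b≈d ∘ ⊥-respˡ b a≈c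

isZero-lines : ∀ c d {v u} → dir c ≡ v → dir d ≡ u → v ≢ u →
  isZero ⟨ line c , line d ⟩ ≡ isZero ⟨ rep v 𝟎 , rep u 𝟎 ⟩ + (syndrome c · u) + (syndrome d · v)
isZero-lines (flag v v≢𝟎 s s⊥v) (flag u u≢𝟎 r r⊥u) refl refl v≢u = rep-orthogonal v v≢𝟎 u u≢𝟎 v≢u s s⊥v r r⊥u

+-rearrange : ∀ k a b c d → (k + a + b ≡ k + c + d) ⇔ (a + c ≡ b + d)
+-rearrange k a b c d = let f , g = implications k a b c d in mk⇔ f g
  where
  implications : ∀ k a b c d → (k + a + b ≡ k + c + d → a + c ≡ b + d) × (a + c ≡ b + d → k + a + b ≡ k + c + d)
  implications = toWitness {a? = allℙ? λ k → allℙ? λ a → allℙ? λ b → allℙ? λ c → allℙ? λ d →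
    ((k + a + b ℙ.≟ k + c + d) →-dec (a + c ℙ.≟ b + d)) ×-dec ((a + c ℙ.≟ b + d) →-dec (k + a + b ℙ.≟ k + c + d))} _

-- Orbits, and the complement of the switched graph.

module _ (𝓥 : OrbitEnumeration) where
  open OrbitEnumeration 𝓥 using (index; cong-index; orbits; onto; V)

  dir≡⇒index≡ : ∀ x y → dir (flagOf x) ≡ dir (flagOf y) → index x ≡ index y
  dir≡⇒index≡ x y v≡u = begin
    index x                                          ≡⟨ from (orbits _ x) (base-orbit x) ⟨
    index (base (dir (flagOf x)) (dir≢𝟎 (flagOf x))) ≡⟨ cong-index (inj₁ λ k → cong (λ v → rep v 𝟎 k) v≡u) ⟩
    index (base (dir (flagOf y)) (dir≢𝟎 (flagOf y))) ≡⟨ from (orbits _ y) (base-orbit y) ⟩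
    index y                                          ∎

  -- The zero vector takes the extra index, so that an injection from 16 indices exhausts 𝔽₂⁴.
  orbitDir : Fin 16 → F 4
  orbitDir zero    = 𝟎
  orbitDir (suc i) = dir (flagOf (proj₁ (onto i)))

  orbitDir-injective : Injective _≡_ _≡_ orbitDir
  orbitDir-injective {zero}  {zero}  _ = refl
  orbitDir-injective {zero}  {suc j} e = contradiction (sym e) (dir≢𝟎 (flagOf (proj₁ (onto j))))
  orbitDir-injective {suc i} {zero}  e = contradiction e (dir≢𝟎 (flagOf (proj₁ (onto i))))
  orbitDir-injective {suc i} {suc j} e = cong suc (trans (sym (proj₂ (onto i)))
    (trans (dir≡⇒index≡ (proj₁ (onto i)) (proj₁ (onto j)) e) (proj₂ (onto j))))

  -- There are as many orbits as nonzero vectors in 𝔽₂⁴, so distinct directions lie in distinct orbits.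
  dir≡orbitDir : ∀ x → dir (flagOf x) ≡ orbitDir (suc (index x))
  dir≡orbitDir x = place (injective⇒exhaustive {xs = vectors 4} refl orbitDir-injective
                            (∈-vectors ∘ orbitDir) (∈-vectors (dir (flagOf x))))
    where
    place : (∃[ j ] dir (flagOf x) ≡ orbitDir j) → dir (flagOf x) ≡ orbitDir (suc (index x))
    place (zero  , e) = contradiction e (dir≢𝟎 (flagOf x))
    place (suc i , e) = trans e (cong (orbitDir ∘ suc) (sym (trans (dir≡⇒index≡ x (proj₁ (onto i)) e) (proj₂ (onto i)))))

  index≡⇒dir≡ : ∀ x y → index x ≡ index y → dir (flagOf x) ≡ dir (flagOf y)
  index≡⇒dir≡ x y e = trans (dir≡orbitDir x) (trans (cong (orbitDir ∘ suc) e) (sym (dir≡orbitDir y)))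

  module _ (w : Fin 15 → Root) (w∈V : ∀ i → w i ∈ V i) where
    private
      frame : Root → Flag
      frame x = flagOf (w (index x))

      offset : Root → F 4
      offset x = syndrome (frame x)

      dir-frame : ∀ x → dir (frame x) ≡ dir (flagOf x)
      dir-frame x = index≡⇒dir≡ (w (index x)) x (w∈V (index x))

      offset-cong : ∀ x y → dir (flagOf x) ≡ dir (flagOf y) → offset x ≡ offset y
      offset-cong x y e = cong (syndrome ∘ flagOf ∘ w) (dir≡⇒index≡ x y e)

      -- Moves the origin of the orbit to its chosen root: under `toFlag` each `w i` gets syndrome
      -- `𝟎`.
      shift : (c : Flag) (x : Root) → dir (flagOf x) ≡ dir c → Flag
      shift (flag v v≢𝟎 s s⊥v) x e = flag v v≢𝟎 (s ⊕ offset x) (begin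
        (s ⊕ offset x) · v          ≡⟨ ·-distribʳ-⊕ v s (offset x) ⟩
        (s · v) + (offset x · v)    ≡⟨ cong₂ _+_ s⊥v (trans (cong (offset x ·_) (sym (trans (dir-frame x) e))) (incident (frame x))) ⟩
        0ℙ                          ∎)

      toFlag : Root → Flag
      toFlag x = shift (flagOf x) x refl

      baseOf : Flag → Root
      baseOf c = base (dir c) (dir≢𝟎 c)

      dir-baseOf : ∀ c → dir (flagOf (baseOf c)) ≡ dir c
      dir-baseOf c = proj₁ (flagOf-unique (baseOf c) (origin (dir c) (dir≢𝟎 c)) (inj₁ λ _ → refl))

      -- The offset depends on the orbit alone, so `baseOf c` can supply it, and adding it a second
      -- time cancels it.
      fromFlag : Flag → Root
      fromFlag c = rootOf (shift c (baseOf c) (dir-baseOf c))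

      toFlag-cong : ∀ x y → vec x ≈± vec y → dir (toFlag x) ≡ dir (toFlag y) × syndrome (toFlag x) ≡ syndrome (toFlag y)
      toFlag-cong x y x≈y = let v≡u , s≡r = flagOf-cong x y x≈y in v≡u , cong₂ _⊕_ s≡r (offset-cong x y v≡u)

      fromFlag-cong : ∀ c d → dir c ≡ dir d × syndrome c ≡ syndrome d → vec (fromFlag c) ≈± vec (fromFlag d)
      fromFlag-cong c d (v≡u , s≡r) = inj₁ λ k → cong₂ (λ v s → rep v s k) v≡u
        (cong₂ _⊕_ s≡r (offset-cong (baseOf c) (baseOf d) (trans (dir-baseOf c) (trans v≡u (sym (dir-baseOf d))))))

      toFlag-fromFlag : ∀ c → dir (toFlag (fromFlag c)) ≡ dir c × syndrome (toFlag (fromFlag c)) ≡ syndrome c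
      toFlag-fromFlag c =
        let x       = fromFlag c
            b       = baseOf c
            v≡ , s≡ = flagOf-unique x (shift c b (dir-baseOf c)) (inj₁ λ _ → refl)
        in v≡ , (begin
          syndrome (flagOf x) ⊕ offset x       ≡⟨ cong₂ _⊕_ s≡ (offset-cong x b (trans v≡ (sym (dir-baseOf c)))) ⟩
          (syndrome c ⊕ offset b) ⊕ offset b   ≡⟨ ⊕-cancelʳ (syndrome c) (offset b) ⟩
          syndrome c                           ∎)

      fromFlag-toFlag : ∀ x → vec (fromFlag (toFlag x)) ≈± vec x
      fromFlag-toFlag x = ≈±-trans (inj₁ λ k → cong (λ s → rep (dir (flagOf x)) s k) (begin
          (syndrome (flagOf x) ⊕ offset x) ⊕ offset b ≡⟨ cong ((syndrome (flagOf x) ⊕ offset x) ⊕_) (offset-cong b x (dir-baseOf (toFlag x))) ⟩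
          (syndrome (flagOf x) ⊕ offset x) ⊕ offset x ≡⟨ ⊕-cancelʳ (syndrome (flagOf x)) (offset x) ⟩
          syndrome (flagOf x)                         ∎))
        (≈±-sym (≈±-line x))
        where b = baseOf (toFlag x)

      -- Lines and chosen roots have the same directions, hence the same constant `k`. It cancels,
      -- and the remaining terms group into the shifted syndromes.
      unswitched⇔ : ∀ x y → dir (flagOf x) ≢ dir (flagOf y) →
        (¬ Switched 𝓥 w x y) ⇔ (syndrome (toFlag x) · dir (flagOf y) ≡ syndrome (toFlag y) · dir (flagOf x))
      unswitched⇔ x y v≢u = mk⇔
        (λ unsw → subst id linear (to (+-rearrange k a b c d) (subst id bits≡ (to (isZero≡⇔ _ _) unsw))))
        (λ e → from (isZero≡⇔ _ _) (subst id (sym bits≡) (from (+-rearrange k a b c d) (subst id (sym linear) e))))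
        where
        v = dir (flagOf x)
        u = dir (flagOf y)
        k = isZero ⟨ rep v 𝟎 , rep u 𝟎 ⟩
        a = syndrome (flagOf x) · u
        b = syndrome (flagOf y) · v
        c = offset x · u
        d = offset y · v

        bits≡ : (isZero ⟨ vec x , vec y ⟩ ≡ isZero ⟨ vec (w (index x)) , vec (w (index y)) ⟩) ≡ (k + a + b ≡ k + c + d)
        bits≡ = cong₂ _≡_
          (trans (isZero-roots x y) (isZero-lines (flagOf x) (flagOf y) refl refl v≢u))
          (trans (isZero-roots (w (index x)) (w (index y))) (isZero-lines (frame x) (frame y) (dir-frame x) (dir-frame y) v≢u))

        linear : (a + c ≡ b + d) ≡ (syndrome (toFlag x) · u ≡ syndrome (toFlag y) · v)
        linear = sym (cong₂ _≡_ (·-distribʳ-⊕ u (syndrome (flagOf x)) (offset x)) (·-distribʳ-⊕ v (syndrome (flagOf y)) (offset y)))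

      -- Distinct lines of one orbit are orthogonal, while the chosen root is not orthogonal to
      -- itself, so such lines are always adjacent after switching.
      nonadjacent⇒dir≢ : ∀ x y → ¬ (vec x ≈± vec y) → ¬ Switched 𝓥 w x y → dir (flagOf x) ≢ dir (flagOf y)
      nonadjacent⇒dir≢ x y x≉y unsw v≡u = unsw (inj₁ (sameFrame , orthogonal))
        where
        sameFrame : ⟨ vec (w (index x)) , vec (w (index y)) ⟩ ≢ 0ℤ
        sameFrame = subst (λ i → ⟨ vec (w (index x)) , vec (w i) ⟩ ≢ 0ℤ) (dir≡⇒index≡ x y v≡u)
          (root-anisotropic _ (isRoot (w (index x))))

        orthogonalFlags : ∀ c d → dir c ≡ dir d → syndrome c ≢ syndrome d → ⟨ line c , line d ⟩ ≡ 0ℤ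
        orthogonalFlags (flag v v≢𝟎 s s⊥v) (flag _ _ r r⊥v) refl = rep-frame v v≢𝟎 s s⊥v r r⊥v

        orthogonal : ⟨ vec x , vec y ⟩ ≡ 0ℤ
        orthogonal = ⊥-respʳ (vec x) (≈±-sym (≈±-line y)) (⊥-respˡ (line (flagOf y)) (≈±-sym (≈±-line x))
          (orthogonalFlags (flagOf x) (flagOf y) v≡u λ s≡r → x≉y (flagOf-injective x y v≡u s≡r)))

    complement≅Flags : complement (G^ 𝓥 w) ≅ Flags
    complement≅Flags = record
      { bijection = record
        { to        = toFlag
        ; from      = fromFlag
        ; to-cong   = λ {x} {y} → toFlag-cong x y
        ; from-cong = λ {c} {d} → fromFlag-cong c d
        ; inverse   = (λ {c} {x} x≈c → let p , q = toFlag-cong x (fromFlag c) x≈c ; p′ , q′ = toFlag-fromFlag c in trans p p′ , trans q q′)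
                    , (λ {x} {c} c≈x → ≈±-trans (fromFlag-cong c (toFlag x) c≈x) (fromFlag-toFlag x))
        }
      ; adjacency = λ x y → mk⇔
        (λ (x≉y , unsw) → let v≢u = nonadjacent⇒dir≢ x y x≉y unsw in v≢u , to (unswitched⇔ x y v≢u) unsw)
        (λ (v≢u , e) → (λ x≈y → v≢u (proj₁ (flagOf-cong x y x≈y))) , from (unswitched⇔ x y v≢u) e)
      }

≅-trans : ∀ {G H K} → G ≅ H → H ≅ K → G ≅ K
≅-trans G≅H H≅K = record
  { bijection = Composition.inverse (_≅_.bijection G≅H) (_≅_.bijection H≅K)
  ; adjacency = λ x y → Composition.equivalence (_≅_.adjacency G≅H x y) (_≅_.adjacency H≅K _ _)
  }

theorem3p12 : (𝓥 : OrbitEnumeration) (w : Fin 15 → Root) →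
    (∀ i → w i ∈ OrbitEnumeration.V 𝓥 i) →
    (A₀ : IndependentSet) →
    complement (G^ 𝓥 w) ≅ Γ₁ A₀
theorem3p12 𝓥 w w∈V A₀ = ≅-trans (complement≅Flags 𝓥 w w∈V) (Flags≅Γ₁ A₀)
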